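{- Let $(\hat G,\hat T)$ be a synthesis of a skeleton comb $(G,T;A,B)$ and a set of tooth grafts $\{(G_v,T_v;r_v):v\in B\}$. Then: (i) a set of edges of $\hat G$ is a minimum join of $(\hat G,\hat T)$ if and only if it is of the form $F\cup\bigcup_{v\in B}F_v$, where $F$ is a minimum join of $(G,T)$ (its edges identified with the corresponding edges of $\hat G$) and, for every $v\in B$, $F_v$ is a minimum join of $(G_v,(T_v\,\Delta\,\{r_v\})\,\Delta\,\{r'_v\})$, where $r'_v\in V(G_v)$ is the end in $V(G_v)$ of the edge of $\hat G$ corresponding to the unique edge of $\delta_G(v)\cap F$; (ii) for every minimum join of $(G,T)$, there is a minimum join of $(\hat G,\hat T)$ containing (the edges of $\hat G$ corresponding to) it.
   Context: All graphs are finite (parallel edges allowed). A graft is a pair $(G,T)$ with $T\subseteq V(G)$; a join is $F\subseteq E(G)$ such that each vertex is incident to an odd number of edges of $F$ iff it lies in $T$; a minimum join is one of minimum size. $\delta_G(Y)$: edges with exactly one end in $Y$; $E_G[Y,Z]$: edges joining $Y$ and $Z$. For $F\subseteq E$ and a subgraph $Q$, $w_F(Q)=|E(Q)\setminus F|-|E(Q)\cap F|$; $\lambda_{(G,T),F}(x,y)$ is the minimum of $w_F(P)$ over paths between $x$ and $y$ ($0$ if $x=y$). A comb $(G,T;A,B)$ is a bipartite graft with color classes $A$ (spine set) and $B$ (tooth set) such that every minimum join $F$ satisfies $|\delta_G(v)\cap F|=1$ for all $v\in B$. A graft $(H,S)$ is primal with respect to $r$ if $\lambda_{(H,S),F'}(r,x)\le0$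 for all $x$ ($F'$ a minimum join); then $A_{(H,S)}(r):=\{x:\lambda_{(H,S),F'}(r,x)=0\}$. Graft contraction: identify a vertex set $Y$ into one vertex (deleting edges inside $Y$), the new vertex being terminal iff $|Y\cap S|$ is odd. Synthesis: given a comb $(G,T;A,B)$ and, for each $v\in B$, a bipartite graft $(G_v,T_v)$ with color classes $A_v,B_v$, primal with respect to $r_v\in A_v$ (all pairwise disjoint and disjoint from $G$), a bipartite graft $(\hat G,\hat T)$ is a synthesis if (1) each $G_v$ is a subgraph of $\hat G$ with the edges of $\hat G$ inside $V(G_v)$ exactly $E(G_v)$ and $\hat T\cap V(G_v)=T_v\Delta\{r_v\}$; (2) contracting each $V(G_v)$ into $v$ yields exactly $(G,T)$ (so edges of $G$ correspond to edges of $\hat G$); (3) $\delta_{\hat G}(V(G_v))=E_{\hat G}[A,A_{(G_v,T_v)}(r_v)]$. -}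

module Defs where

open import Data.Nat using (ℕ; zero; suc; _≤_; _%_)
open import Data.Integer as ℤ using (ℤ; +_; -[1+_])
open import Data.Bool using (Bool; true; false; if_then_else_; _xor_; not)
open import Data.Fin using (Fin; _≟_)
open import Data.Fin.Subset using (Subset; _∈_; _∉_; ∣_∣; _∩_; ⊤; ⁅_⁆)
open import Data.Vec using (Vec; tabulate; zipWith; lookup)
open import Data.List using (List; []; _∷_)
open import Data.List.Relation.Unary.Unique.Propositional using (Unique)
open import Data.Product using (Σ; ∃; ∃-syntax; _×_; _,_; proj₁; proj₂)
open import Data.Sum using (_⊎_)
open import Relation.Nullary using (¬_)
open import Relation.Nullary.Decidable using (⌊_⌋)
open import Relation.Binary.PropositionalEquality using (_≡_; _≢_)
open import Function.Bundles using (_⇔_)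

-- Finite multigraphs: vertices Fin nV, edges Fin nE, each edge has an
-- (arbitrarily oriented) pair of ends.  Parallel edges allowed.

record Graph : Set where
  field
    nV    : ℕ
    nE    : ℕ
    ends  : Fin nE → Fin nV × Fin nV
open Graph public

module _ (g : Graph) where

  IsEnd : Fin (nV g) → Fin (nE g) → Set
  IsEnd v e = (proj₁ (ends g e) ≡ v) ⊎ (proj₂ (ends g e) ≡ v)

  isEnd : Fin (nV g) → Fin (nE g) → Bool
  isEnd v e = ⌊ proj₁ (ends g e) ≟ v ⌋ Data.Bool.∨ ⌊ proj₂ (ends g e) ≟ v ⌋

  -- δ(v) as an edge set (for loopless graphs, the incident edges)
  star : Fin (nV g) → Subset (nE g)
  star v = tabulate (isEnd v)

  deg : Subset (nE g) → Fin (nV g) → ℕ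
  deg F v = ∣ F ∩ star v ∣

  Joins : Fin (nE g) → Fin (nV g) → Fin (nV g) → Set
  Joins e x y = (ends g e ≡ (x , y)) ⊎ (ends g e ≡ (y , x))

Odd : ℕ → Set
Odd n = n % 2 ≡ 1

_Δ_ : ∀ {n} → Subset n → Subset n → Subset n
_Δ_ = zipWith _xor_

fibre : ∀ {n N} → (Fin N → Fin n) → Fin n → Subset N
fibre φ v = tabulate (λ x → ⌊ φ x ≟ v ⌋)

-- Grafts on induced subgraphs g[U] (U = ⊤ gives the whole graph).

module _ (g : Graph) (U : Subset (nV g)) where

  EdgesIn : Subset (nE g) → Set
  EdgesIn F = ∀ e → e ∈ F → (proj₁ (ends g e) ∈ U) × (proj₂ (ends g e) ∈ U)

  IsJoinIn : Subset (nV g) → Subset (nE g) → Set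
  IsJoinIn T F = EdgesIn F × (∀ v → v ∈ U → (Odd (deg g F v) ⇔ (v ∈ T)))

  IsMinJoinIn : Subset (nV g) → Subset (nE g) → Set
  IsMinJoinIn T F = IsJoinIn T F × (∀ F' → IsJoinIn T F' → ∣ F ∣ ≤ ∣ F' ∣)

  data Walk : Fin (nV g) → Fin (nV g) → Set where
    nil  : ∀ {x} → x ∈ U → Walk x x
    cons : ∀ {x z y} (e : Fin (nE g)) → Joins g e x z → x ∈ U → Walk z y → Walk x y

  walkVertices : ∀ {x y} → Walk x y → List (Fin (nV g))
  walkVertices (nil {x} _) = x ∷ []
  walkVertices (cons {x} e _ _ w) = x ∷ walkVertices w

  Path : Fin (nV g) → Fin (nV g) → Set
  Path x y = Σ (Walk x y) (λ w → Unique (walkVertices w))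

  weightW : Subset (nE g) → ∀ {x y} → Walk x y → ℤ
  weightW F (nil _) = + 0
  weightW F (cons e _ _ w) = (if lookup F e then -[1+ 0 ] else + 1) ℤ.+ weightW F w

  weight : Subset (nE g) → ∀ {x y} → Path x y → ℤ
  weight F P = weightW F (proj₁ P)

  IsLambda : Subset (nE g) → Fin (nV g) → Fin (nV g) → ℤ → Set
  IsLambda F x y k = (Σ (Path x y) (λ P → weight F P ≡ k))
                   × (∀ (P : Path x y) → k ℤ.≤ weight F P)

  Primal : Subset (nV g) → Fin (nV g) → Set
  Primal T r = (∃ λ F → IsMinJoinIn T F)
             × (∀ F → IsMinJoinIn T F → ∀ x → x ∈ U →
                  ∃ λ k → IsLambda F r x k × (k ℤ.≤ + 0))

  InA : Subset (nV g) → Fin (nV g) → Fin (nV g) → Set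
  InA T r x = x ∈ U × (∀ F → IsMinJoinIn T F → IsLambda F r x (+ 0))

  IsBipartition : Subset (nV g) → Subset (nV g) → Set
  IsBipartition A B =
      (∀ x → (x ∈ U) ⇔ ((x ∈ A) ⊎ (x ∈ B)))
    × (∀ x → ¬ ((x ∈ A) × (x ∈ B)))
    × (∀ e → proj₁ (ends g e) ∈ U → proj₂ (ends g e) ∈ U →
         ((proj₁ (ends g e) ∈ A) × (proj₂ (ends g e) ∈ B))
       ⊎ ((proj₁ (ends g e) ∈ B) × (proj₂ (ends g e) ∈ A)))

IsJoin : (g : Graph) → Subset (nV g) → Subset (nE g) → Set
IsJoin g = IsJoinIn g ⊤

IsMinJoin : (g : Graph) → Subset (nV g) → Subset (nE g) → Set
IsMinJoin g = IsMinJoinIn g ⊤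

IsBipartiteGraft : Graph → Set
IsBipartiteGraft g = ∃[ A ] ∃[ B ] IsBipartition g ⊤ A B

IsComb : (g : Graph) → Subset (nV g) → Subset (nV g) → Subset (nV g) → Set
IsComb g T A B = IsBipartition g ⊤ A B
               × (∀ F → IsMinJoin g T F → ∀ v → v ∈ B → deg g F v ≡ 1)

-- Synthesis.
-- Skeleton comb (G,T;A,B); synthesized graft (Ĝ,T̂).
-- φ : V(Ĝ) → V(G) is the contraction map: for v ∈ B, V(G_v) = φ⁻¹(v);
--   each a ∈ A has exactly one preimage (the vertex of Ĝ identified with a).
-- The tooth graft G_v is the induced subgraph Ĝ[φ⁻¹(v)] (condition (1)),
--   with terminal set Tt v, colour classes Av v, Bv v and root r v.
-- ψ : E(G) → E(Ĝ) is the edge correspondence of condition (2).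

record IsSynthesis (G : Graph) (T A B : Subset (nV G))
                   (Ĝ : Graph) (T̂ : Subset (nV Ĝ))
                   (φ : Fin (nV Ĝ) → Fin (nV G))
                   (ψ : Fin (nE G) → Fin (nE Ĝ))
                   (Tt Av Bv : Fin (nV G) → Subset (nV Ĝ))
                   (r : Fin (nV G) → Fin (nV Ĝ)) : Set where
  field
    comb        : IsComb G T A B
    hatBip      : IsBipartiteGraft Ĝ
    toothBip    : ∀ v → v ∈ B → IsBipartition Ĝ (fibre φ v) (Av v) (Bv v)
    rootIn      : ∀ v → v ∈ B → r v ∈ Av v
    toothPrimal : ∀ v → v ∈ B → Primal Ĝ (fibre φ v) (Tt v) (r v)
    cond1       : ∀ v → v ∈ B → T̂ ∩ fibre φ v ≡ Tt v Δ ⁅ r v ⁆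
    -- (2) contraction yields (G,T)
    contrA      : ∀ a → a ∈ A → ∃ λ x → (φ x ≡ a) × (∀ y → φ y ≡ a → y ≡ x)
    contrTerm   : ∀ u → (u ∈ T) ⇔ Odd ∣ T̂ ∩ fibre φ u ∣
    ψ-inj       : ∀ e e' → ψ e ≡ ψ e' → e ≡ e'
    ψ-image     : ∀ ê → (∃ λ e → ψ e ≡ ê)
                        ⇔ (φ (proj₁ (ends Ĝ ê)) ≢ φ (proj₂ (ends Ĝ ê)))
    ψ-ends      : ∀ e → Joins G e (φ (proj₁ (ends Ĝ (ψ e)))) (φ (proj₂ (ends Ĝ (ψ e))))
    cond3       : ∀ v → v ∈ B → ∀ ê →
      (  ((proj₁ (ends Ĝ ê) ∈ fibre φ v) × (proj₂ (ends Ĝ ê) ∉ fibre φ v))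
       ⊎ ((proj₁ (ends Ĝ ê) ∉ fibre φ v) × (proj₂ (ends Ĝ ê) ∈ fibre φ v)))
      ⇔ (∃[ x ] ∃[ y ] Joins Ĝ ê x y × (φ x ∈ A) × InA Ĝ (fibre φ v) (Tt v) (r v) y)

{-# OPTIONS --safe #-}
module Submission where

-- Contracting the teeth turns a join F̂ of Ĝ into a join F of G, and |F̂| is |F| plus the sizes of
-- the parts of F̂ inside the teeth.  The part inside G_v is a join for T_v Δ {r_v} Δ X, where X is
-- contained in A(r_v).  The heart of the matter is that such a join is never smaller than the
-- minimum n_v for (G_v, T_v); it has size n_v for a suitable join whenever X is a single vertex.
-- Hence |F̂| ≥ |F| + Σ n_v, with equality attained over every minimum F because of the comb
-- property, and both parts follow from the equality case.
--
-- The bound in a primal bipartite graft is proved in the style of Sebő's proof of Seymour's theorem: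
-- let h(u) be the least size of a join for T_v Δ {r_v} Δ {u}, take b minimising h, and contract b
-- together with its neighbours.  This lowers h by exactly one at every vertex of A(r_v), keeps the
-- graft bipartite and primal, and lowers the size of every join with X ⊆ A(r_v) by at least one.
-- Instead of contracting, the edges of the star get cost 0.

open import Defs
open import Algebra.Bundles using (CommutativeMonoid; CommutativeRing)
import Algebra.Properties.CommutativeMonoid.Sum
import Algebra.Properties.Semiring.Sum
open import Data.Bool using (Bool; true; false; _∧_; _∨_; _xor_; not; if_then_else_)
open import Data.Bool.Properties using
  ( xor-∧-commutativeRing; xor-same; xor-identityʳ; xor-assoc; xor-comm
  ; ∧-zeroʳ; ∧-identityʳ; ∧-comm; ∧-distribˡ-xor; ∧-distribʳ-xor; ∨-identityʳ )
open import Data.Bool.Solver using (module xor-∧-Solver)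
open import Data.Empty using (⊥-elim)
open import Data.Fin using (Fin; zero; suc; _≟_)
open import Data.Fin.Properties using (any?; all?)
open import Data.Fin.Subset using (Subset; _∈_; _∉_; ∣_∣; _∩_; ⊤; ⁅_⁆)
open import Data.Fin.Subset.Properties using (anySubset?; ∈⊤; _∈?_; x∈⁅x⁆; x∈⁅y⁆⇒x≡y)
open import Data.Integer as ℤ using (-[1+_]) renaming (+_ to ⁺_)
import Data.Integer.Properties as ℤₚ
import Data.List.Membership.DecPropositional as DecMembership
open import Data.List.Membership.Propositional using () renaming (_∈_ to _∈ᴸ_)
open import Data.List.Relation.Unary.All using ([]; _∷_)
open import Data.List.Relation.Unary.All.Properties using (¬Any⇒All¬; All¬⇒¬Any)
open import Data.List.Relation.Unary.AllPairs using ([]; _∷_)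
open import Data.List.Relation.Unary.Any using (here; there)
open import Data.List.Relation.Unary.Unique.Propositional using (Unique)
open import Data.Nat as ℕ using (ℕ; zero; suc; _+_; _≤_; _<_; z≤n; s≤s)
import Data.Nat.Properties as ℕₚ
open import Data.Product using (Σ; ∃; _×_; _,_; proj₁; proj₂)
open import Data.Sum using (_⊎_; inj₁; inj₂)
open import Data.Unit using (tt) renaming (⊤ to Unit)
open import Data.Vec using ([]; _∷_; lookup; tabulate)
open import Data.Vec.Properties using (lookup∘tabulate; lookup-zipWith; []=⇒lookup; lookup⇒[]=)
open import Function using (_∘_)
open import Function.Bundles using (_⇔_; mk⇔; module Equivalence)
open import Level using (0ℓ)
open import Relation.Binary.PropositionalEquality hiding (J)
open import Relation.Nullary using (¬_; Dec; yes; no; contradiction; does)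
open import Relation.Nullary.Decidable using (⌊_⌋; _×-dec_; _→-dec_; map′; dec-true; dec-false; isYes≗does)
open Equivalence using (to; from)
open xor-∧-Solver using (solve; _:=_; _:+_; _:*_)

-- The obstacle is a set `X` with three or more vertices. The difference of such a join and a
-- minimum join of (G_v, T_v) splits into circuits, one path from r_v to `X`, and paths pairing up
-- the rest of `X`. Membership in A(r_v) controls only distances from r_v and says nothing directly
-- about the pairing paths, so the bound cannot be read off path by path. The induction therefore
-- treats a join as a whole and uses of `X` only that h is large on it.
--
-- Three features keep the induction going. Bipartiteness is kept as a potential: the cost of an
-- edge is the difference modulo 2 of a vertex labelling, and contracting around a set adds its
-- indicator to the labelling. Primality is kept as an upper bound on h at the ends of edges that
-- still cost something. Finally, if the minimum of h has reached this bound, h is constant on such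
-- ends, while parity makes it differ across an edge of cost 1; so no costly edge is left.
--
-- Edge sets are Boolean functions and joins are prescribed boundaries modulo 2, which turns every
-- rerouting of a join into an identity for `xor`.

true≢false : true ≢ false
true≢false ()

≢true⇒≡false : ∀ {b} → b ≢ true → b ≡ false
≢true⇒≡false {false} _ = refl
≢true⇒≡false {true}  h = contradiction refl h

∧-trueˡ : ∀ {a b} → a ∧ b ≡ true → a ≡ true
∧-trueˡ {true} _ = refl

∧-trueʳ : ∀ {a b} → a ∧ b ≡ true → b ≡ true
∧-trueʳ {true} h = h

∧-intro : ∀ {a b} → a ≡ true → b ≡ true → a ∧ b ≡ true
∧-intro refl refl = refl

⌊⌋-true : ∀ {n} {x y : Fin n} → x ≡ y → ⌊ x ≟ y ⌋ ≡ true
⌊⌋-true {x = x} {y} h = trans (isYes≗does (x ≟ y)) (dec-true (x ≟ y) h)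

⌊⌋-false : ∀ {n} {x y : Fin n} → x ≢ y → ⌊ x ≟ y ⌋ ≡ false
⌊⌋-false {x = x} {y} h = trans (isYes≗does (x ≟ y)) (dec-false (x ≟ y) h)

⌊⌋-sound : ∀ {n} {x y : Fin n} → ⌊ x ≟ y ⌋ ≡ true → x ≡ y
⌊⌋-sound {x = x} {y} h with x ≟ y
... | yes p = p
... | no _  = contradiction (sym h) true≢false

-- Finite sums, modulo 2 and over the natural numbers.

module SumLemmas (M : CommutativeMonoid 0ℓ 0ℓ) where
  open CommutativeMonoid M renaming (refl to ≈-refl; sym to ≈-sym; trans to ≈-trans)
  open Algebra.Properties.CommutativeMonoid.Sum M

  sum-zero : ∀ {n} (f : Fin n → Carrier) → (∀ i → f i ≈ ε) → sum f ≈ ε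
  sum-zero {n} f h = ≈-trans (sum-cong-≋ h) (sum-replicate-zero n)

  sum-single : ∀ {n} (f : Fin n → Carrier) x → (∀ i → i ≢ x → f i ≈ ε) → sum f ≈ f x
  sum-single {suc n} f zero h =
    ≈-trans (∙-congˡ (sum-zero (f ∘ suc) λ i → h (suc i) λ ())) (identityʳ _)
  sum-single {suc n} f (suc x) h =
    ≈-trans (∙-cong (h zero λ ()) (sum-single (f ∘ suc) x λ i i≢x → h (suc i) λ { refl → i≢x refl }))
            (identityˡ _)

  -- Write `f j` as the sum over `i` of `f j` where `ψ i` is `j`: injectivity leaves at most one
  -- term, and off the image both sides vanish. Then exchange the two sums.
  sum-reindex : ∀ {m n} (ψ : Fin m → Fin n) → (∀ i j → ψ i ≡ ψ j → i ≡ j) →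
    (f : Fin n → Carrier) → (∀ j → (∀ i → ψ i ≢ j) → f j ≈ ε) → sum f ≈ sum (f ∘ ψ)
  sum-reindex {m} {n} ψ inj f off =
    ≈-trans (sum-cong-≋ expand) (≈-trans (∑-comm (λ j i → at i j)) (sum-cong-≋ collapse))
    where
    at : Fin m → Fin n → Carrier
    at i j = if ⌊ ψ i ≟ j ⌋ then f j else ε
    at-hit : ∀ i j → ψ i ≡ j → at i j ≈ f j
    at-hit i j h rewrite ⌊⌋-true h = ≈-refl
    at-miss : ∀ i j → ψ i ≢ j → at i j ≈ ε
    at-miss i j h rewrite ⌊⌋-false h = ≈-refl
    expand : ∀ j → f j ≈ sum (λ i → at i j)
    expand j with any? (λ i → ψ i ≟ j)
    ... | yes (i , refl) = ≈-sym (≈-trans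
            (sum-single (λ k → at k (ψ i)) i (λ k k≢i → at-miss k (ψ i) (k≢i ∘ inj k i)))
            (at-hit i (ψ i) refl))
    ... | no none = ≈-trans (off j λ i h → none (i , h))
            (≈-sym (sum-zero _ λ i → at-miss i j λ h → none (i , h)))
    collapse : ∀ i → sum (at i) ≈ f (ψ i)
    collapse i = ≈-trans (sum-single (at i) (ψ i) λ j j≢ → at-miss i j (j≢ ∘ sym)) (at-hit i (ψ i) refl)

module ⊕ where
  open Algebra.Properties.Semiring.Sum (CommutativeRing.semiring xor-∧-commutativeRing) public
  open SumLemmas (CommutativeRing.+-commutativeMonoid xor-∧-commutativeRing) public

module ∑ where
  open Algebra.Properties.Semiring.Sum ℕₚ.+-*-semiring public
  open SumLemmas ℕₚ.+-0-commutativeMonoid public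

⊕-true : ∀ {n} (f : Fin n → Bool) → ⊕.sum f ≡ true → ∃ λ i → f i ≡ true
⊕-true {suc n} f h with f zero in eq
... | true  = zero , eq
... | false = let i , p = ⊕-true (f ∘ suc) h in suc i , p

sum-mono : ∀ {n} (f g : Fin n → ℕ) → (∀ i → f i ≤ g i) → ∑.sum f ≤ ∑.sum g
sum-mono {zero}  f g h = z≤n
sum-mono {suc n} f g h = ℕₚ.+-mono-≤ (h zero) (sum-mono (f ∘ suc) (g ∘ suc) (h ∘ suc))

sum-tight : ∀ {n} (f g : Fin n → ℕ) → (∀ i → f i ≤ g i) → ∑.sum g ≤ ∑.sum f → ∀ i → f i ≡ g i
sum-tight {suc n} f g h le zero =
  ℕₚ.≤-antisym (h zero)
    (ℕₚ.+-cancelʳ-≤ (∑.sum (g ∘ suc)) _ _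
      (ℕₚ.≤-trans le (ℕₚ.+-monoʳ-≤ (f zero) (sum-mono (f ∘ suc) (g ∘ suc) (h ∘ suc)))))
sum-tight {suc n} f g h le (suc i) =
  sum-tight (f ∘ suc) (g ∘ suc) (h ∘ suc)
    (ℕₚ.+-cancelˡ-≤ (g zero) _ _ (ℕₚ.≤-trans le (ℕₚ.+-monoˡ-≤ (∑.sum (f ∘ suc)) (h zero)))) i

-- Edge sets as Boolean functions: symmetric difference, size and 0/1 cost.

infixr 6 _⊻_
infixr 7 _⊓_

_⊻_ _⊓_ : ∀ {n} (J K : Fin n → Bool) → Fin n → Bool
(J ⊻ K) e = J e xor K e
(J ⊓ K) e = J e ∧ K e

_⊑_ : ∀ {n} (J K : Fin n → Bool) → Set
J ⊑ K = ∀ e → J e ≡ true → K e ≡ true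

single : ∀ {n} → Fin n → Fin n → Bool
single x y = ⌊ x ≟ y ⌋

⟦_⟧ : Bool → ℕ
⟦ true ⟧  = 1
⟦ false ⟧ = 0

count : ∀ {n} → (Fin n → Bool) → ℕ
count J = ∑.sum (⟦_⟧ ∘ J)

odd? : ℕ → Bool
odd? zero    = false
odd? (suc n) = not (odd? n)

count-cong : ∀ {n} (J K : Fin n → Bool) → (∀ e → J e ≡ K e) → count J ≡ count K
count-cong J K h = ∑.sum-cong-≗ (λ e → cong ⟦_⟧ (h e))

count-mono : ∀ {n} (J K : Fin n → Bool) → J ⊑ K → count J ≤ count K
count-mono J K h = sum-mono _ _ λ e → pointwise (J e) (K e) (h e)
  where
  pointwise : ∀ a b → (a ≡ true → b ≡ true) → ⟦ a ⟧ ≤ ⟦ b ⟧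
  pointwise false b _ = z≤n
  pointwise true  b h rewrite h refl = ℕₚ.≤-refl

count-single : ∀ {n} (e : Fin n) → count (single e) ≡ 1
count-single e = trans
  (∑.sum-single _ e λ i i≢e → cong ⟦_⟧ (⌊⌋-false (i≢e ∘ sym)))
  (cong ⟦_⟧ (⌊⌋-true {x = e} refl))

⊕-select : ∀ {n} (p : Fin n → Bool) x → ⊕.sum (λ v → p v ∧ single x v) ≡ p x
⊕-select p x = trans
  (⊕.sum-single _ x λ v v≢x → trans (cong (p v ∧_) (⌊⌋-false (v≢x ∘ sym))) (∧-zeroʳ (p v)))
  (trans (cong (p x ∧_) (⌊⌋-true {x = x} refl)) (∧-identityʳ (p x)))

count-strict : ∀ {n} (J K : Fin n → Bool) x → J ⊑ K → J x ≡ false → K x ≡ true → count J < count K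
count-strict J K x sub j k = begin-strict
  count J                        <⟨ ℕₚ.n<1+n (count J) ⟩
  1 + count J                    ≡⟨ cong (λ i → i + count J) (count-single x) ⟨
  count (single x) + count J     ≡⟨ ∑.∑-distrib-+ (⟦_⟧ ∘ single x) (⟦_⟧ ∘ J) ⟨
  ∑.sum (λ i → ⟦ single x i ⟧ + ⟦ J i ⟧)
    ≤⟨ sum-mono _ _ (λ i → pointwise (single x i) (J i) (K i) (sub i)
         (λ h → subst (λ v → J v ≡ false) (⌊⌋-sound h) j) (λ h → subst (λ v → K v ≡ true) (⌊⌋-sound h) k)) ⟩
  count K ∎
  where
  open ℕₚ.≤-Reasoning
  pointwise : ∀ s a b → (a ≡ true → b ≡ true) → (s ≡ true → a ≡ false) → (s ≡ true → b ≡ true) →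
    ⟦ s ⟧ + ⟦ a ⟧ ≤ ⟦ b ⟧
  pointwise false false b _ _ _ = z≤n
  pointwise false true  b h _ _ rewrite h refl = ℕₚ.≤-refl
  pointwise true  false b _ _ h rewrite h refl = ℕₚ.≤-refl
  pointwise true  true  b _ h _ = contradiction (h refl) true≢false

odd?-count : ∀ {n} (J : Fin n → Bool) → odd? (count J) ≡ ⊕.sum J
odd?-count {zero}  J = refl
odd?-count {suc n} J with J zero
... | true  = cong not (odd?-count (J ∘ suc))
... | false = odd?-count (J ∘ suc)

-- `c` marks the edges that still count; an edge outside `c` behaves as if contracted.
cost : ∀ {n} (c J : Fin n → Bool) → ℕ
cost c J = count (J ⊓ c)

cost-cong : ∀ {n} (c J K : Fin n → Bool) → (∀ e → J e ≡ K e) → cost c J ≡ cost c K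
cost-cong c J K h = count-cong (J ⊓ c) (K ⊓ c) λ e → cong (_∧ c e) (h e)

cost-⊻ : ∀ {n} (c J K : Fin n → Bool) → cost c (J ⊻ K) ≤ cost c J + cost c K
cost-⊻ c J K = ℕₚ.≤-trans (sum-mono _ _ λ e → pointwise (J e) (K e) (c e))
                           (ℕₚ.≤-reflexive (∑.∑-distrib-+ (⟦_⟧ ∘ (J ⊓ c)) (⟦_⟧ ∘ (K ⊓ c))))
  where
  pointwise : ∀ j k d → ⟦ (j xor k) ∧ d ⟧ ≤ ⟦ j ∧ d ⟧ + ⟦ k ∧ d ⟧
  pointwise false k     d     = ℕₚ.≤-refl
  pointwise true  false d     = ℕₚ.m≤m+n _ _
  pointwise true  true  d     = z≤n

-- Every edge of `P` lies in exactly one of `J` and `K`, so toggling `P` in both merely moves it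
-- from one set to the other.
cost-exchange : ∀ {n} (c P J K : Fin n → Bool) → P ⊑ (J ⊻ K) →
  cost c (J ⊻ P) + cost c (K ⊻ P) ≡ cost c J + cost c K
cost-exchange c P J K sub =
  trans (sym (∑.∑-distrib-+ (⟦_⟧ ∘ ((J ⊻ P) ⊓ c)) (⟦_⟧ ∘ ((K ⊻ P) ⊓ c))))
    (trans (∑.sum-cong-≗ λ e → pointwise (P e) (J e) (K e) (c e) (sub e))
           (∑.∑-distrib-+ (⟦_⟧ ∘ (J ⊓ c)) (⟦_⟧ ∘ (K ⊓ c))))
  where
  pointwise : ∀ p j k d → (p ≡ true → j xor k ≡ true) →
    ⟦ (j xor p) ∧ d ⟧ + ⟦ (k xor p) ∧ d ⟧ ≡ ⟦ j ∧ d ⟧ + ⟦ k ∧ d ⟧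
  pointwise false false false d     _ = refl
  pointwise false false true  d     _ = refl
  pointwise false true  false d     _ = refl
  pointwise false true  true  d     _ = refl
  pointwise true  false false d     h = contradiction (sym (h refl)) true≢false
  pointwise true  false true  d     h = ℕₚ.+-identityʳ _
  pointwise true  true  false d     h = sym (ℕₚ.+-identityʳ _)
  pointwise true  true  true  d     h = contradiction (sym (h refl)) true≢false

cost-remove : ∀ {n} (c P J : Fin n → Bool) → P ⊑ J →
  cost c (J ⊻ P) + cost c P ≡ cost c J
cost-remove c P J sub =
  trans (sym (∑.∑-distrib-+ (⟦_⟧ ∘ ((J ⊻ P) ⊓ c)) (⟦_⟧ ∘ (P ⊓ c)))) (∑.sum-cong-≗ λ e → pointwise (P e) (J e) (c e) (sub e))
  where
  pointwise : ∀ p j d → (p ≡ true → j ≡ true) → ⟦ (j xor p) ∧ d ⟧ + ⟦ p ∧ d ⟧ ≡ ⟦ j ∧ d ⟧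
  pointwise false false d _ = refl
  pointwise false true  d _ = ℕₚ.+-identityʳ _
  pointwise true  false d h = contradiction (sym (h refl)) true≢false
  pointwise true  true  d _ = refl

cost-single : ∀ {n} (c : Fin n → Bool) e → cost c (single e) ≡ ⟦ c e ⟧
cost-single c e = trans
  (∑.sum-single _ e λ i i≢e → cong (λ b → ⟦ b ∧ c i ⟧) (⌊⌋-false (i≢e ∘ sym)))
  (cong (λ b → ⟦ b ∧ c e ⟧) (⌊⌋-true {x = e} refl))

single-⊑ : ∀ {n} (J : Fin n → Bool) {e} → J e ≡ true → single e ⊑ J
single-⊑ J h e' p = trans (cong J (sym (⌊⌋-sound p))) h

-- The search runs over subsets; `resp` stands in for function extensionality between a function and
-- its tabulation.
anyFunction? : ∀ {n} {P : (Fin n → Bool) → Set} → (∀ {J K} → (∀ e → J e ≡ K e) → P J → P K) →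
  (∀ J → Dec (P J)) → Dec (∃ P)
anyFunction? {n} resp P? with anySubset? (P? ∘ lookup {n = n})
... | yes (J , p) = yes (lookup J , p)
... | no none     = no λ (J , p) → none (tabulate J , resp (sym ∘ lookup∘tabulate J) p)

-- Boundaries of edge sets modulo 2.

module Boundary (g : Graph) where

  P Q : Fin (nE g) → Fin (nV g)
  P = proj₁ ∘ ends g
  Q = proj₂ ∘ ends g

  -- The two ends enter through `xor`, so that a loop has empty boundary; `Localise` relies on this.
  inc : Fin (nE g) → Fin (nV g) → Bool
  inc e v = single (P e) v xor single (Q e) v

  ∂ : (Fin (nE g) → Bool) → Fin (nV g) → Bool
  ∂ J v = ⊕.sum λ e → J e ∧ inc e v

  ∂-cong : ∀ J K → (∀ e → J e ≡ K e) → ∀ v → ∂ J v ≡ ∂ K v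
  ∂-cong J K h v = ⊕.sum-cong-≗ λ e → cong (_∧ inc e v) (h e)

  ∂-⊻ : ∀ J K v → ∂ (J ⊻ K) v ≡ ∂ J v xor ∂ K v
  ∂-⊻ J K v = trans (⊕.sum-cong-≗ λ e → pointwise (J e) (K e) (inc e v))
    (⊕.∑-distrib-+ (λ e → J e ∧ inc e v) (λ e → K e ∧ inc e v))
    where
    pointwise : ∀ a b i → (a xor b) ∧ i ≡ (a ∧ i) xor (b ∧ i)
    pointwise a b i = ∧-distribʳ-xor i a b

  ∂-single : ∀ e v → ∂ (single e) v ≡ inc e v
  ∂-single e v = trans
    (⊕.sum-single _ e λ i i≢e → cong (_∧ inc i v) (⌊⌋-false (i≢e ∘ sym)))
    (cong (_∧ inc e v) (⌊⌋-true {x = e} refl))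

  Joins-inc : ∀ {e x y} → Joins g e x y → ∀ v → inc e v ≡ single x v xor single y v
  Joins-inc (inj₁ refl) v = refl
  Joins-inc {e} {x} {y} (inj₂ refl) v = xor-comm (single y v) (single x v)

  inc-end : ∀ e v → inc e v ≡ true → P e ≡ v ⊎ Q e ≡ v
  inc-end e v h with P e ≟ v | Q e ≟ v
  ... | yes p | _     = inj₁ p
  ... | no _  | yes q = inj₂ q

  ∂-avoid : ∀ K v → (∀ e → K e ≡ true → P e ≢ v × Q e ≢ v) → ∂ K v ≡ false
  ∂-avoid K v h = ⊕.sum-zero (λ e → K e ∧ inc e v) λ e → ≢true⇒≡false λ k∧i →
    let k = ∧-trueˡ {K e} k∧i in
    contra e (h e k) (inc-end e v (∧-trueʳ {K e} k∧i))
    where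
    contra : ∀ {A : Set} e → P e ≢ v × Q e ≢ v → P e ≡ v ⊎ Q e ≡ v → A
    contra e (p , _) (inj₁ h) = contradiction h p
    contra e (_ , q) (inj₂ h) = contradiction h q

  -- Evaluating a vertex potential on a boundary turns it into an edge count.
  ∂-potential : ∀ (p : Fin (nV g) → Bool) J →
    ⊕.sum (λ v → p v ∧ ∂ J v) ≡ ⊕.sum (λ e → J e ∧ (p (P e) xor p (Q e)))
  ∂-potential p J = begin
    ⊕.sum (λ v → p v ∧ ∂ J v)
      ≡⟨ ⊕.sum-cong-≗ (λ v → ⊕.*-distribˡ-sum (p v) (λ e → J e ∧ inc e v)) ⟩
    ⊕.sum (λ v → ⊕.sum λ e → p v ∧ (J e ∧ inc e v))       ≡⟨ ⊕.∑-comm (λ v e → p v ∧ (J e ∧ inc e v)) ⟩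
    ⊕.sum (λ e → ⊕.sum λ v → p v ∧ (J e ∧ inc e v))       ≡⟨ ⊕.sum-cong-≗ atEdge ⟩
    ⊕.sum (λ e → J e ∧ (p (P e) xor p (Q e)))             ∎
    where
    open ≡-Reasoning
    regroup : ∀ a j s t → a ∧ (j ∧ (s xor t)) ≡ j ∧ ((a ∧ s) xor (a ∧ t))
    regroup = solve 4 (λ a j s t → a :* (j :* (s :+ t)) := j :* (a :* s :+ a :* t)) refl
    atEdge : ∀ e → ⊕.sum (λ v → p v ∧ (J e ∧ inc e v)) ≡ J e ∧ (p (P e) xor p (Q e))
    atEdge e = begin
      ⊕.sum (λ v → p v ∧ (J e ∧ inc e v))
        ≡⟨ ⊕.sum-cong-≗ (λ v → regroup (p v) (J e) (single (P e) v) (single (Q e) v)) ⟩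
      ⊕.sum (λ v → J e ∧ ((p v ∧ single (P e) v) xor (p v ∧ single (Q e) v)))
        ≡⟨ ⊕.*-distribˡ-sum (J e) (λ v → (p v ∧ single (P e) v) xor (p v ∧ single (Q e) v)) ⟨
      J e ∧ ⊕.sum (λ v → (p v ∧ single (P e) v) xor (p v ∧ single (Q e) v))
        ≡⟨ cong (J e ∧_) (⊕.∑-distrib-+ (λ v → p v ∧ single (P e) v) (λ v → p v ∧ single (Q e) v)) ⟩
      J e ∧ (⊕.sum (λ v → p v ∧ single (P e) v) xor ⊕.sum (λ v → p v ∧ single (Q e) v))
        ≡⟨ cong (J e ∧_) (cong₂ _xor_ (⊕-select p (P e)) (⊕-select p (Q e))) ⟩
      J e ∧ (p (P e) xor p (Q e)) ∎

-- Walks and paths as edge sets.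

count-toggle : ∀ {n} (J : Fin n → Bool) e →
  ⁺ count (J ⊻ single e) ≡ (if J e then -[1+ 0 ] else ⁺ 1) ℤ.+ ⁺ count J
count-toggle J e with J e in eq
... | true  = begin
    ⁺ count (J ⊻ single e)                       ≡⟨⟩
    -[1+ 0 ] ℤ.+ ⁺ (1 + count (J ⊻ single e))    ≡⟨ cong (λ k → -[1+ 0 ] ℤ.+ ⁺ k) (ℕₚ.+-comm 1 _) ⟩
    -[1+ 0 ] ℤ.+ ⁺ (count (J ⊻ single e) + 1)    ≡⟨ cong (λ k → -[1+ 0 ] ℤ.+ ⁺ k) removed ⟩
    -[1+ 0 ] ℤ.+ ⁺ count J                       ∎
  where
  open ≡-Reasoning
  pointwise : ∀ p j → (p ≡ true → j ≡ true) → ⟦ j xor p ⟧ + ⟦ p ⟧ ≡ ⟦ j ⟧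
  pointwise false false _ = refl
  pointwise false true  _ = refl
  pointwise true  false h = contradiction (sym (h refl)) true≢false
  pointwise true  true  _ = refl
  removed : count (J ⊻ single e) + 1 ≡ count J
  removed = trans (cong (λ k → count (J ⊻ single e) + k) (sym (count-single e)))
    (trans (sym (∑.∑-distrib-+ (⟦_⟧ ∘ (J ⊻ single e)) (⟦_⟧ ∘ single e)))
           (∑.sum-cong-≗ λ i → pointwise (single e i) (J i) (single-⊑ J eq i)))
... | false = cong ⁺_ (trans (∑.sum-cong-≗ λ i → pointwise (single e i) (J i) (disjoint i))
    (trans (∑.∑-distrib-+ (⟦_⟧ ∘ single e) (⟦_⟧ ∘ J)) (cong (λ k → k + count J) (count-single e))))
  where
  pointwise : ∀ p j → (p ≡ true → j ≡ false) → ⟦ j xor p ⟧ ≡ ⟦ p ⟧ + ⟦ j ⟧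
  pointwise false false _ = refl
  pointwise false true  _ = refl
  pointwise true  false _ = refl
  pointwise true  true  h = contradiction (h refl) true≢false
  disjoint : ∀ i → single e i ≡ true → J i ≡ false
  disjoint i p = trans (cong J (sym (⌊⌋-sound p))) eq

module WalkSets (g : Graph) (U : Subset (nV g)) where
  open Boundary g

  private
    E = Fin (nE g)

  -- Edges are collected modulo 2, so repeated edges cancel in pairs. The boundary formula thus
  -- holds for every walk, whereas the weight formula is stated for paths.
  edgeSet : ∀ {x y} → Walk g U x y → E → Bool
  edgeSet (nil _)        = λ _ → false
  edgeSet (cons e _ _ w) = single e ⊻ edgeSet w

  Within : (E → Bool) → ∀ {x y} → Walk g U x y → Set
  Within K (nil _)        = Unit
  Within K (cons e _ _ w) = K e ≡ true × Within K w

  Within-mono : ∀ {K L} → K ⊑ L → ∀ {x y} (w : Walk g U x y) → Within K w → Within L w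
  Within-mono h (nil _)        _         = tt
  Within-mono h (cons e _ _ w) (k , win) = h e k , Within-mono h w win

  Within⇒⊑ : ∀ {K x y} (w : Walk g U x y) → Within K w → edgeSet w ⊑ K
  Within⇒⊑ {K} (cons e j x∈ w) (k , win) e' h with single e e' in eq
  ... | true  = single-⊑ K k e' eq
  ... | false = Within⇒⊑ w win e' h

  ∂-edgeSet : ∀ {x y} (w : Walk g U x y) v → ∂ (edgeSet w) v ≡ single x v xor single y v
  ∂-edgeSet (nil {x} _) v = trans (⊕.sum-zero (λ e → false ∧ inc e v) λ _ → refl) (sym (xor-same (single x v)))
  ∂-edgeSet (cons {x} {z} {y} e j _ w) v = begin
    ∂ (single e ⊻ edgeSet w) v                                      ≡⟨ ∂-⊻ (single e) (edgeSet w) v ⟩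
    ∂ (single e) v xor ∂ (edgeSet w) v                              ≡⟨ cong₂ _xor_ (∂-single e v) (∂-edgeSet w v) ⟩
    inc e v xor (single z v xor single y v)                         ≡⟨ cong (_xor _) (Joins-inc {e} j v) ⟩
    (single x v xor single z v) xor (single z v xor single y v)     ≡⟨ telescope (single x v) (single z v) (single y v) ⟩
    single x v xor single y v ∎
    where
    open ≡-Reasoning
    telescope : ∀ a b c → (a xor b) xor (b xor c) ≡ a xor c
    telescope a b c = trans (xor-assoc a b (b xor c))
      (cong (a xor_) (trans (sym (xor-assoc b b c)) (cong (_xor c) (xor-same b))))

  head∈ : ∀ {x y} (w : Walk g U x y) → x ∈ᴸ walkVertices g U w
  head∈ (nil _)        = here refl
  head∈ (cons _ _ _ _) = here refl

  edge-ends∈ : ∀ {x y} (w : Walk g U x y) e → edgeSet w e ≡ true →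
    ∀ v → IsEnd g v e → v ∈ᴸ walkVertices g U w
  edge-ends∈ (cons e j _ w) e' h v end with single e e' in eq
  edge-ends∈ (cons e j _ w) e' h v end | false = there (edge-ends∈ w e' h v end)
  edge-ends∈ (cons e (inj₁ refl) _ w) e' h v end | true with ⌊⌋-sound eq
  edge-ends∈ (cons e (inj₁ refl) _ w) e' h v (inj₁ refl) | true | refl = here refl
  edge-ends∈ (cons e (inj₁ refl) _ w) e' h v (inj₂ refl) | true | refl = there (head∈ w)
  edge-ends∈ (cons e (inj₂ refl) _ w) e' h v end | true with ⌊⌋-sound eq
  edge-ends∈ (cons e (inj₂ refl) _ w) e' h v (inj₁ refl) | true | refl = there (head∈ w)
  edge-ends∈ (cons e (inj₂ refl) _ w) e' h v (inj₂ refl) | true | refl = here refl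

  joins-start : ∀ {e x z} → Joins g e x z → IsEnd g x e
  joins-start (inj₁ eq) = inj₁ (cong proj₁ eq)
  joins-start (inj₂ eq) = inj₂ (cong proj₂ eq)

  path-count : ∀ (F : Subset (nE g)) {x y} (w : Walk g U x y) → Unique (walkVertices g U w) →
    ⁺ count (lookup F ⊻ edgeSet w) ≡ weightW g U F w ℤ.+ ⁺ count (lookup F)
  path-count F (nil _) _ = cong ⁺_ (count-cong _ (lookup F) λ e → xor-identityʳ (lookup F e))
  path-count F (cons {x} e j x∈ w) (x≢ ∷ uniq) = begin
    ⁺ count (lookup F ⊻ (single e ⊻ edgeSet w))
      ≡⟨ cong ⁺_ (count-cong (lookup F ⊻ (single e ⊻ edgeSet w)) ((lookup F ⊻ edgeSet w) ⊻ single e)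
           λ i → rotate (lookup F i) (single e i) (edgeSet w i)) ⟩
    ⁺ count ((lookup F ⊻ edgeSet w) ⊻ single e)
      ≡⟨ count-toggle (lookup F ⊻ edgeSet w) e ⟩
    (if (lookup F ⊻ edgeSet w) e then -[1+ 0 ] else ⁺ 1) ℤ.+ ⁺ count (lookup F ⊻ edgeSet w)
      ≡⟨ cong₂ (λ b k → (if b then -[1+ 0 ] else ⁺ 1) ℤ.+ k) fresh (path-count F w uniq) ⟩
    (if lookup F e then -[1+ 0 ] else ⁺ 1) ℤ.+ (weightW g U F w ℤ.+ ⁺ count (lookup F))
      ≡⟨ ℤₚ.+-assoc (if lookup F e then -[1+ 0 ] else ⁺ 1) (weightW g U F w) (⁺ count (lookup F)) ⟨
    weightW g U F (cons e j x∈ w) ℤ.+ ⁺ count (lookup F) ∎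
    where
    open ≡-Reasoning
    rotate : ∀ a b c → a xor (b xor c) ≡ (a xor c) xor b
    rotate a b c = trans (cong (a xor_) (xor-comm b c)) (sym (xor-assoc a c b))
    -- A later repetition of `e` would put `x` on the rest of the walk; hence each edge of a path is
    -- toggled once and contributes its signed weight.
    fresh : (lookup F ⊻ edgeSet w) e ≡ lookup F e
    fresh = trans (cong (lookup F e xor_) (≢true⇒≡false λ h →
      All¬⇒¬Any x≢ (edge-ends∈ w e h x (joins-start j)))) (xor-identityʳ _)

  suffix : ∀ {K z y} (w : Walk g U z y) → Unique (walkVertices g U w) → Within K w →
    ∀ {x} → x ∈ᴸ walkVertices g U w → Σ (Path g U x y) λ p → Within K (proj₁ p)
  suffix w@(nil _)        u         win       (here refl) = (w , u) , win
  suffix w@(cons _ _ _ _) u         win       (here refl) = (w , u) , win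
  suffix (cons _ _ _ w)   (_ ∷ u)   (_ , win) (there x∈)  = suffix w u win x∈

  other-end : ∀ e x → inc e x ≡ true → ∃ λ z → Joins g e x z × x ≢ z × inc e z ≡ true
  other-end e x h with P e ≟ x | Q e ≟ x
  other-end e x h | yes refl | no q≢ = Q e , inj₁ refl , (q≢ ∘ sym) ,
    cong₂ _xor_ (⌊⌋-false (q≢ ∘ sym)) (⌊⌋-true {x = Q e} refl)
  other-end e x h | no p≢ | yes refl = P e , inj₂ refl , (p≢ ∘ sym) ,
    cong₂ _xor_ (⌊⌋-true {x = P e} refl) (⌊⌋-false (p≢ ∘ sym))

  Inside : (E → Bool) → Set
  Inside K = ∀ e → K e ≡ true → P e ∈ U × Q e ∈ U

  joins∈ : ∀ {K e x z} → Inside K → K e ≡ true → Joins g e x z → x ∈ U × z ∈ U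
  joins∈ {e = e} ins k (inj₁ refl) = ins e k
  joins∈ {e = e} ins k (inj₂ refl) = proj₂ (ins e k) , proj₁ (ins e k)

  -- Leave `x` by an edge `e` of `K`. If its other end `z` is odd, stop; otherwise `z` becomes odd
  -- once `e` is removed, and induction on the size of `K` continues from there. This is also the
  -- handshake lemma: an odd vertex is never alone.
  extractPath : ∀ K → Inside K → ∀ x → ∂ K x ≡ true →
    ∃ λ y → y ≢ x × ∂ K y ≡ true × Σ (Path g U x y) λ p → Within K (proj₁ p)
  extractPath K ins x = go (count K) K ℕₚ.≤-refl ins x
    where
    go : ∀ k K → count K ≤ k → Inside K → ∀ x → ∂ K x ≡ true →
      ∃ λ y → y ≢ x × ∂ K y ≡ true × Σ (Path g U x y) λ p → Within K (proj₁ p)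
    go k K le ins x odd
      with e , e∧ ← ⊕-true (λ e → K e ∧ inc e x) odd
      with e∈K ← ∧-trueˡ {K e} e∧
      with z , j , x≢z , z∈e ← other-end e x (∧-trueʳ {K e} e∧)
      with x∈U , z∈U ← joins∈ ins e∈K j
      with ∂ K z in ∂z
    ... | true = z , x≢z ∘ sym , ∂z ,
          (cons e j x∈U (nil z∈U) , (x≢z ∷ []) ∷ ([] ∷ [])) , e∈K , tt
    ... | false = extend k le
      where
      K' = K ⊻ single e
      K'⊑K : K' ⊑ K
      K'⊑K i h with single e i in eq
      ... | true  = single-⊑ K e∈K i eq
      ... | false = trans (sym (xor-identityʳ (K i))) h
      smaller : count K' < count K
      smaller = count-strict K' K e K'⊑K (cong₂ _xor_ e∈K (⌊⌋-true {x = e} refl)) e∈K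
      ∂K' : ∀ v → ∂ K' v ≡ ∂ K v xor inc e v
      ∂K' v = trans (∂-⊻ K (single e) v) (cong (∂ K v xor_) (∂-single e v))
      x∈e : inc e x ≡ true
      x∈e = ∧-trueʳ {K e} e∧
      extend : ∀ k → count K ≤ k →
        ∃ λ y → y ≢ x × ∂ K y ≡ true × Σ (Path g U x y) λ p → Within K (proj₁ p)
      extend zero le = contradiction (ℕₚ.<-≤-trans smaller le) λ ()
      extend (suc k) le
        with y , y≢z , ∂y , (w , uniq) , win ←
          go k K' (ℕ.s≤s⁻¹ (ℕₚ.<-≤-trans smaller le)) (λ i h → ins i (K'⊑K i h)) z
             (trans (∂K' z) (cong₂ _xor_ ∂z z∈e))
        = y , y≢x , trans (sym (trans (∂K' y) (trans (cong (∂ K y xor_) y∉e) (xor-identityʳ _)))) ∂y , path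
        where
        -- Removing `e` has made `x` even.
        y≢x : y ≢ x
        y≢x refl = true≢false (trans (sym ∂y) (trans (∂K' x) (cong₂ _xor_ odd x∈e)))
        y∉e : inc e y ≡ false
        y∉e = trans (Joins-inc {e} j y) (cong₂ _xor_ (⌊⌋-false (y≢x ∘ sym)) (⌊⌋-false (y≢z ∘ sym)))
        win' = Within-mono K'⊑K w win
        path : Σ (Path g U x y) λ p → Within K (proj₁ p)
        -- If the path from `z` runs through `x`, its part after `x` already suffices; otherwise `e`
        -- can be put in front without repeating a vertex.
        path with DecMembership._∈?_ _≟_ x (walkVertices g U w)
        ... | yes x∈w = suffix w uniq win' x∈w
        ... | no x∉w  = (cons e j x∈U w , ¬Any⇒All¬ _ x∉w ∷ uniq) , e∈K , win'

  subpath : ∀ K → Inside K → ∀ x → ∂ K x ≡ true →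
    ∃ λ y → ∃ λ L → y ≢ x × ∂ K y ≡ true × L ⊑ K × (∀ v → ∂ L v ≡ single x v xor single y v)
  subpath K ins x odd with y , y≢x , ∂y , (w , _) , win ← extractPath K ins x odd =
    y , edgeSet w , y≢x , ∂y , Within⇒⊑ w win , ∂-edgeSet w

minimise : ∀ {A : Set} (f : A → ℕ) → (∀ k → Dec (∃ λ a → f a < k)) → A →
  ∃ λ a → ∀ a' → f a ≤ f a'
minimise {A} f search a₀ = go (f a₀) a₀ ℕₚ.≤-refl
  where
  go : ∀ k a → f a ≤ k → ∃ λ a → ∀ a' → f a ≤ f a'
  go k a le with search (f a)
  ... | no none = a , λ a' → ℕₚ.≮⇒≥ λ lt → none (a' , lt)
  go zero    a le | yes (a' , lt) = contradiction (ℕₚ.<-≤-trans lt le) λ ()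
  go (suc k) a le | yes (a' , lt) = go k a' (ℕ.s≤s⁻¹ (ℕₚ.<-≤-trans lt le))

-- Joins with one movable terminal, under costs given by a potential.

module JoinsAt (g : Graph) (T : Fin (nV g) → Bool) where
  open Boundary g
  open WalkSets g ⊤

  private
    E = Fin (nE g)
    V = Fin (nV g)

  inside-⊤ : ∀ K → Inside K
  inside-⊤ K e _ = ∈⊤ , ∈⊤

  -- In the application `T` is T_v Δ {r_v}, so the least cost of such a `J` is the function h at
  -- `u`.
  JoinAt : V → (E → Bool) → Set
  JoinAt u J = ∀ v → ∂ J v ≡ T v xor single u v

  joinAt? : ∀ u J → Dec (JoinAt u J)
  joinAt? u J = all? λ v → ∂ J v Data.Bool.≟ (T v xor single u v)

  -- `pot` makes every circuit have even cost, so the parity of a cost depends on the boundary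
  -- alone. This is the form of bipartiteness that survives contraction.
  module Potential (c : E → Bool) (p : V → Bool) (pot : ∀ e → c e ≡ p (P e) xor p (Q e)) where

    odd?-cost : ∀ J → odd? (cost c J) ≡ ⊕.sum (λ v → p v ∧ ∂ J v)
    odd?-cost J = trans (odd?-count (J ⊓ c))
      (trans (⊕.sum-cong-≗ λ e → cong (J e ∧_) (pot e)) (sym (∂-potential p J)))

    odd?-boundary : ∀ (S : V → Bool) u J → (∀ v → ∂ J v ≡ S v xor single u v) →
      odd? (cost c J) ≡ ⊕.sum (λ v → p v ∧ S v) xor p u
    odd?-boundary S u J bd = begin
      odd? (cost c J)
        ≡⟨ odd?-cost J ⟩
      ⊕.sum (λ v → p v ∧ ∂ J v)
        ≡⟨ ⊕.sum-cong-≗ (λ v → trans (cong (p v ∧_) (bd v)) (∧-distribˡ-xor (p v) (S v) (single u v))) ⟩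
      ⊕.sum (λ v → (p v ∧ S v) xor (p v ∧ single u v))
        ≡⟨ ⊕.∑-distrib-+ (λ v → p v ∧ S v) (λ v → p v ∧ single u v) ⟩
      ⊕.sum (λ v → p v ∧ S v) xor ⊕.sum (λ v → p v ∧ single u v)
        ≡⟨ cong (⊕.sum (λ v → p v ∧ S v) xor_) (⊕-select p u) ⟩
      ⊕.sum (λ v → p v ∧ S v) xor p u ∎
      where open ≡-Reasoning

    odd?-joinAt : ∀ {u} J → JoinAt u J → odd? (cost c J) ≡ ⊕.sum (λ v → p v ∧ T v) xor p u
    odd?-joinAt {u} = odd?-boundary T u

    odd?-path : ∀ {x y} K → (∀ v → ∂ K v ≡ single x v xor single y v) → odd? (cost c K) ≡ p x xor p y
    odd?-path {x} {y} K bd = trans (odd?-boundary (single x) y K bd) (cong (_xor p y) (⊕-select p x))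

  module Split (C : V → Bool) where

    inner outer cross : E → Bool
    inner e = C (P e) ∧ C (Q e)
    outer e = not (C (P e)) ∧ not (C (Q e))
    cross e = C (P e) xor C (Q e)

    trisect : ∀ J e → J e ≡ (J ⊓ inner) e xor ((J ⊓ outer) e xor (J ⊓ cross) e)
    trisect J e = pointwise (J e) (C (P e)) (C (Q e))
      where
      pointwise : ∀ j a b → j ≡ (j ∧ (a ∧ b)) xor ((j ∧ (not a ∧ not b)) xor (j ∧ (a xor b)))
      pointwise false _     _     = refl
      pointwise true  false false = refl
      pointwise true  false true  = refl
      pointwise true  true  false = refl
      pointwise true  true  true  = refl

    ∂-trisect : ∀ J v → ∂ J v ≡ ∂ (J ⊓ inner) v xor (∂ (J ⊓ outer) v xor ∂ (J ⊓ cross) v)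
    ∂-trisect J v = trans (∂-cong J _ (trisect J) v)
      (trans (∂-⊻ (J ⊓ inner) ((J ⊓ outer) ⊻ (J ⊓ cross)) v)
             (cong (∂ (J ⊓ inner) v xor_) (∂-⊻ (J ⊓ outer) (J ⊓ cross) v)))

    ∂-inner : ∀ J v → C v ≡ false → ∂ (J ⊓ inner) v ≡ false
    ∂-inner J v v∉ = ∂-avoid (J ⊓ inner) v λ e h →
      let i = ∧-trueʳ {J e} h in
      (λ { refl → true≢false (trans (sym (∧-trueˡ {C (P e)} i)) v∉) }) ,
      (λ { refl → true≢false (trans (sym (∧-trueʳ {C (P e)} i)) v∉) })

    not-true : ∀ {b} → not b ≡ true → b ≡ false
    not-true {false} _ = refl

    ∂-outer : ∀ J v → C v ≡ true → ∂ (J ⊓ outer) v ≡ false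
    ∂-outer J v v∈ = ∂-avoid (J ⊓ outer) v λ e h →
      let o = ∧-trueʳ {J e} h in
      (λ { refl → true≢false (trans (sym v∈) (not-true (∧-trueˡ {not (C (P e))} o))) }) ,
      (λ { refl → true≢false (trans (sym v∈) (not-true (∧-trueʳ {not (C (P e))} o))) })

    ∂-at-outer : ∀ J v → C v ≡ false → ∂ J v ≡ ∂ (J ⊓ outer) v xor ∂ (J ⊓ cross) v
    ∂-at-outer J v v∉ = trans (∂-trisect J v)
      (cong (_xor (∂ (J ⊓ outer) v xor ∂ (J ⊓ cross) v)) (∂-inner J v v∉))

    ∂-at-inner : ∀ J v → C v ≡ true → ∂ J v ≡ ∂ (J ⊓ inner) v xor ∂ (J ⊓ cross) v
    ∂-at-inner J v v∈ = trans (∂-trisect J v)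
      (cong (∂ (J ⊓ inner) v xor_) (cong (_xor ∂ (J ⊓ cross) v) (∂-outer J v v∈)))

    ∂-cross-free : ∀ J → (∀ e → J e ≡ true → cross e ≡ false) → ∀ v → ∂ (J ⊓ cross) v ≡ false
    ∂-cross-free J free v = ⊕.sum-zero (λ e → (J ⊓ cross) e ∧ inc e v) λ e → ≢true⇒≡false λ h →
      let jc = ∧-trueˡ {(J ⊓ cross) e} h in
      true≢false (trans (sym (∧-trueʳ {J e} jc)) (free e (∧-trueˡ {J e} jc)))

    Neighbour : V → Set
    Neighbour z = ∃ λ e → ∃ λ x → Joins g e x z × C x ≡ true × cross e ≡ true

    cross-ends : ∀ e → cross e ≡ true → ∃ λ x → ∃ λ z → Joins g e x z × C x ≡ true × C z ≡ false
    cross-ends e h with C (P e) in p | C (Q e) in q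
    ... | true  | false = P e , Q e , inj₁ refl , p , q
    ... | false | true  = Q e , P e , inj₂ refl , q , p

    ∂-cross⇒neighbour : ∀ J v → C v ≡ false → ∂ (J ⊓ cross) v ≡ true → Neighbour v
    ∂-cross⇒neighbour J v v∉ h
      with e , h' ← ⊕-true (λ e → (J ⊓ cross) e ∧ inc e v) h
      with cr ← ∧-trueʳ {J e} (∧-trueˡ {(J ⊓ cross) e} h')
      with x , z , j , x∈ , z∉ ← cross-ends e cr
      with inc-end e v (∧-trueʳ {(J ⊓ cross) e} h') | j
    ... | inj₁ refl | inj₁ refl = contradiction (trans (sym x∈) v∉) true≢false
    ... | inj₂ refl | inj₁ refl = e , x , inj₁ refl , x∈ , cr
    ... | inj₁ refl | inj₂ refl = e , x , inj₂ refl , x∈ , cr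
    ... | inj₂ refl | inj₂ refl = contradiction (trans (sym x∈) v∉) true≢false

  -- One contraction step around a minimiser.

  FreePath : (E → Bool) → V → V → (E → Bool) → Set
  FreePath c b u K = (∀ v → ∂ K v ≡ single b v xor single u v) × cost c K ≡ 0

  -- Distance zero is witnessed by an edge set with boundary `b` plus `u` and not by a walk: such
  -- sets compose by `xor` and can be searched for exhaustively.
  freeBall : ∀ c b → ∃ λ (C : V → Bool) →
    (∀ u → C u ≡ true → ∃ (FreePath c b u)) × (∀ u K → FreePath c b u K → C u ≡ true)
  freeBall c b = (does ∘ near?) , sound , λ u K path → dec-true (near? u) (K , path)
    where
    near? : ∀ u → Dec (∃ (FreePath c b u))
    near? u = anyFunction?
      (λ {J} {K} eq (bd , z) → (λ v → trans (sym (∂-cong J K eq v)) (bd v)) , trans (sym (cost-cong c J K eq)) z)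
      (λ K → (all? λ v → ∂ K v Data.Bool.≟ (single b v xor single u v)) ×-dec (cost c K ℕ.≟ 0))
    sound : ∀ u → does (near? u) ≡ true → ∃ (FreePath c b u)
    sound u h with near? u
    ... | yes path = path

  -- One step of the contraction argument: b attains the minimum m of c(J) over all u and all
  -- (T Δ u)-joins J, and C is the set of vertices at distance 0 from b, i.e. what b has become
  -- after the previous contractions.
  module Step (c : E → Bool) (p : V → Bool) (pot : ∀ e → c e ≡ p (P e) xor p (Q e))
    (b : V) (M : E → Bool) (M-join : JoinAt b M)
    (M-min : ∀ u J → JoinAt u J → cost c M ≤ cost c J)
    (C : V → Bool) (C⇒path : ∀ u → C u ≡ true → ∃ (FreePath c b u))
    (path⇒C : ∀ u K → FreePath c b u K → C u ≡ true) where

    open Potential c p pot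

    m : ℕ
    m = cost c M

    open Split C

    b∈C : C b ≡ true
    b∈C = path⇒C b (λ _ → false)
      ( (λ v → trans (⊕.sum-zero (λ e → false ∧ inc e v) λ _ → refl) (sym (xor-same (single b v))))
      , ∑.sum-zero (λ e → ⟦ false ∧ c e ⟧) λ _ → refl)

    C-closed : ∀ {e x z} → Joins g e x z → c e ≡ false → C x ≡ true → C z ≡ true
    C-closed {e} {x} {z} j free x∈ with K , bd , zero-cost ← C⇒path x x∈ =
      path⇒C z (K ⊻ single e)
        ( (λ v → trans (∂-⊻ K (single e) v) (trans (cong₂ _xor_ (bd v) (trans (∂-single e v) (Joins-inc {e} j v)))
                   (solve 3 (λ b x z → (b :+ x) :+ (x :+ z) := b :+ z) refl (single b v) (single x v) (single z v))))
        , ℕₚ.n≤0⇒n≡0 (ℕₚ.≤-trans (cost-⊻ c K (single e))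
            (ℕₚ.≤-reflexive (cong₂ _+_ zero-cost (trans (cost-single c e) (cong ⟦_⟧ free))))))

    -- A free edge leaving `C` would put its outer end at distance zero as well.
    cross⇒c : ∀ e → cross e ≡ true → c e ≡ true
    cross⇒c e cr with c e in free
    ... | true = refl
    ... | false with x , z , j , x∈ , z∉ ← cross-ends e cr =
      contradiction (trans (sym (C-closed {e} j free x∈)) z∉) true≢false

    p-const : ∀ u → C u ≡ true → p b xor p u ≡ false
    p-const u u∈ with K , bd , zero-cost ← C⇒path u u∈ =
      trans (sym (odd?-path K bd)) (cong odd? zero-cost)

    -- Zero-cost connections to `b` make `p` constant on `C`, so an edge inside `C` sees no
    -- difference of potential.
    inner⇒¬c : ∀ e → C (P e) ≡ true → C (Q e) ≡ true → c e ≡ false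
    inner⇒¬c e p∈ q∈ = trans (pot e) (trans
      (solve 3 (λ b x y → x :+ y := (b :+ x) :+ (b :+ y)) refl (p b) (p (P e)) (p (Q e)))
      (cong₂ _xor_ (p-const (P e) p∈) (p-const (Q e) q∈)))

    joinAt-near : ∀ u → C u ≡ true → ∃ λ J → JoinAt u J × cost c J ≤ m
    joinAt-near u u∈ with K , bd , zero-cost ← C⇒path u u∈ =
      M ⊻ K ,
      (λ v → trans (∂-⊻ M K v) (trans (cong₂ _xor_ (M-join v) (bd v))
        (solve 3 (λ t b u → (t :+ b) :+ (b :+ u) := t :+ u) refl (T v) (single b v) (single u v)))) ,
      ℕₚ.≤-trans (cost-⊻ c M K) (ℕₚ.≤-reflexive (trans (cong (m +_) zero-cost) (ℕₚ.+-identityʳ m)))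

    -- A free connection from `b` to `x`, followed by `e`, moves the terminal of `M` to `z`; the
    -- free part adds no cost.
    toggle-edge : ∀ {e x z} → Joins g e x z → C x ≡ true →
      ∃ λ J → JoinAt z J × cost c J ≤ cost c (M ⊻ single e)
    toggle-edge {e} {x} {z} j x∈ with K , bd , zero-cost ← C⇒path x x∈ =
      (M ⊻ single e) ⊻ K ,
      (λ v → begin
        ∂ ((M ⊻ single e) ⊻ K) v                ≡⟨ ∂-⊻ (M ⊻ single e) K v ⟩
        ∂ (M ⊻ single e) v xor ∂ K v            ≡⟨ cong₂ _xor_ (∂-⊻ M (single e) v) (bd v) ⟩
        (∂ M v xor ∂ (single e) v) xor (single b v xor single x v)
          ≡⟨ cong (_xor _) (cong₂ _xor_ (M-join v) (trans (∂-single e v) (Joins-inc {e} j v))) ⟩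
        ((T v xor single b v) xor (single x v xor single z v)) xor (single b v xor single x v)
          ≡⟨ solve 4 (λ t b x z → ((t :+ b) :+ (x :+ z)) :+ (b :+ x) := t :+ z)
               refl (T v) (single b v) (single x v) (single z v) ⟩
        T v xor single z v ∎) ,
      ℕₚ.≤-trans (cost-⊻ c (M ⊻ single e) K)
        (ℕₚ.≤-reflexive (trans (cong (cost c (M ⊻ single e) +_) zero-cost) (ℕₚ.+-identityʳ _)))
      where open ≡-Reasoning

    -- Dropping an edge of δ(C) from `M` would move the terminal to its outer end and save 1,
    -- against the minimality of `M` over all vertices.
    M-uncrossed : ∀ e → M e ≡ true → cross e ≡ false
    M-uncrossed e e∈M = ≢true⇒≡false λ cr →
      let x , z , j , x∈ , _ = cross-ends e cr
          J , join , le = toggle-edge {e} j x∈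
          dropped : cost c (M ⊻ single e) + 1 ≡ m
          dropped = trans (cong (cost c (M ⊻ single e) +_)
                            (sym (trans (cost-single c e) (cong ⟦_⟧ (cross⇒c e cr)))))
                          (cost-remove c (single e) M (single-⊑ M e∈M))
      in ℕₚ.<-irrefl refl (ℕₚ.<-≤-trans
           (subst (cost c (M ⊻ single e) <_) (trans (ℕₚ.+-comm 1 _) dropped) (ℕₚ.n<1+n _))
           (ℕₚ.≤-trans (M-min z J join) le))

    -- Since `M` avoids δ(C), it falls apart into these two sets. `Mᵢ` is free, and `Mₒ` is what `M`
    -- becomes when `C` is contracted.
    Mᵢ Mₒ : E → Bool
    Mᵢ = M ⊓ inner
    Mₒ = M ⊓ outer

    ∂-MᵢMₒ : ∀ v → ∂ Mₒ v xor ∂ Mᵢ v ≡ T v xor single b v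
    ∂-MᵢMₒ v = trans (xor-comm (∂ Mₒ v) (∂ Mᵢ v)) (trans (cong (∂ Mᵢ v xor_)
      (sym (trans (cong (∂ Mₒ v xor_) (∂-cross-free M M-uncrossed v)) (xor-identityʳ _))))
      (trans (sym (∂-trisect M v)) (M-join v)))

    cost-Mᵢ : cost c Mᵢ ≡ 0
    cost-Mᵢ = ∑.sum-zero (λ e → ⟦ Mᵢ e ∧ c e ⟧) λ e → cong ⟦_⟧ (≢true⇒≡false λ h →
      let i = ∧-trueʳ {M e} (∧-trueˡ {Mᵢ e} h) in
      true≢false (trans (sym (∧-trueʳ {Mᵢ e} h)) (inner⇒¬c e (∧-trueˡ {C (P e)} i) (∧-trueʳ {C (P e)} i))))

    cost-Mₒ : cost c Mₒ ≤ m
    cost-Mₒ = count-mono (Mₒ ⊓ c) (M ⊓ c) λ e h →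
      ∧-intro (∧-trueˡ {M e} (∧-trueˡ {Mₒ e} h)) (∧-trueʳ {Mₒ e} h)

    -- The deviation at `z` is led along an edge into `C` and freely on to `b`, and `Mᵢ` repairs the
    -- terminals inside `C`. Only the edge into `C` costs, hence the 1.
    lift-odd : ∀ N z u → Neighbour z → (∀ v → ∂ N v ≡ ∂ Mₒ v xor (single z v xor single u v)) →
      ∃ λ J → JoinAt u J × cost c J ≤ cost c N + 1
    lift-odd N z u (e , x , j , x∈ , cr) bd with K , bdK , zero-cost ← C⇒path x x∈ =
      (N ⊻ single e) ⊻ (Mᵢ ⊻ K) ,
      (λ v → begin
        ∂ ((N ⊻ single e) ⊻ (Mᵢ ⊻ K)) v                        ≡⟨ ∂-⊻ (N ⊻ single e) (Mᵢ ⊻ K) v ⟩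
        ∂ (N ⊻ single e) v xor ∂ (Mᵢ ⊻ K) v                    ≡⟨ cong₂ _xor_ (∂-⊻ N (single e) v) (∂-⊻ Mᵢ K v) ⟩
        (∂ N v xor ∂ (single e) v) xor (∂ Mᵢ v xor ∂ K v)
          ≡⟨ cong₂ _xor_ (cong₂ _xor_ (bd v) (trans (∂-single e v) (Joins-inc {e} j v))) (cong (∂ Mᵢ v xor_) (bdK v)) ⟩
        ((∂ Mₒ v xor (single z v xor single u v)) xor (single x v xor single z v)) xor (∂ Mᵢ v xor (single b v xor single x v))
          ≡⟨ solve 6 (λ o z u x i b → ((o :+ (z :+ u)) :+ (x :+ z)) :+ (i :+ (b :+ x)) := (o :+ i) :+ (b :+ u))
               refl (∂ Mₒ v) (single z v) (single u v) (single x v) (∂ Mᵢ v) (single b v) ⟩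
        (∂ Mₒ v xor ∂ Mᵢ v) xor (single b v xor single u v)    ≡⟨ cong (_xor _) (∂-MᵢMₒ v) ⟩
        (T v xor single b v) xor (single b v xor single u v)
          ≡⟨ solve 3 (λ t b u → (t :+ b) :+ (b :+ u) := t :+ u) refl (T v) (single b v) (single u v) ⟩
        T v xor single u v ∎) ,
      ℕₚ.≤-trans (cost-⊻ c (N ⊻ single e) (Mᵢ ⊻ K)) (ℕₚ.≤-trans
        (ℕₚ.+-mono-≤ (cost-⊻ c N (single e)) (cost-⊻ c Mᵢ K))
        (ℕₚ.≤-reflexive (trans
          (cong₂ _+_ (cong (cost c N +_) (trans (cost-single c e) (cong ⟦_⟧ (cross⇒c e cr)))) (cong₂ _+_ cost-Mᵢ zero-cost))
          (ℕₚ.+-identityʳ _))))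
      where open ≡-Reasoning

    -- Adding the free part `Mᵢ` turns `N` into a join at `b`, where the minimality of `M` applies.
    lift-even : ∀ N → (∀ v → ∂ N v ≡ ∂ Mₒ v) → m ≤ cost c N
    lift-even N bd = ℕₚ.≤-trans
      (M-min b (N ⊻ Mᵢ) λ v → trans (∂-⊻ N Mᵢ v) (trans (cong (_xor ∂ Mᵢ v) (bd v)) (∂-MᵢMₒ v)))
      (ℕₚ.≤-trans (cost-⊻ c N Mᵢ) (ℕₚ.≤-reflexive (trans (cong (cost c N +_) cost-Mᵢ) (ℕₚ.+-identityʳ _))))

    -- By parity the value at a neighbour of C differs from the minimum m.
    neighbour-dear : ∀ z → Neighbour z → ∀ J → JoinAt z J → suc m ≤ cost c J
    neighbour-dear z (e , x , j , x∈ , cr) J join = ℕₚ.≤∧≢⇒< (M-min z J join) λ eq →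
      true≢false (trans (sym (cross⇒c e cr)) (trans (pot-joins j)
        (trans (solve 4 (λ t b x z → x :+ z := ((b :+ x) :+ ((t :+ b) :+ (t :+ z)))) refl
                  (⊕.sum (λ v → p v ∧ T v)) (p b) (p x) (p z))
          (cong₂ _xor_ (p-const x x∈)
            (trans (cong₂ _xor_ (sym (odd?-joinAt M M-join)) (sym (odd?-joinAt J join)))
              (trans (cong (λ k → odd? m xor odd? k) (sym eq)) (xor-same (odd? m))))))))
      where
      pot-joins : Joins g e x z → c e ≡ p x xor p z
      pot-joins (inj₁ refl) = pot e
      pot-joins (inj₂ refl) = trans (pot e) (xor-comm (p (P e)) (p (Q e)))

    -- The two defect lemmas below bound a set N whose boundary differs from that of Mₒ only at
    -- neighbours of C: exchanging N and Mₒ along a path between two defects never helps, because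
    -- Mₒ so modified lifts to a join of the graph before contraction.
    defect : (E → Bool) → V → Bool
    defect N = ∂ (N ⊻ Mₒ)

    defect≡ : ∀ N v → ∂ N v ≡ ∂ Mₒ v xor defect N v
    defect≡ N v = trans (solve 2 (λ n o → n := o :+ (n :+ o)) refl (∂ N v) (∂ Mₒ v))
                        (cong (∂ Mₒ v xor_) (sym (∂-⊻ N Mₒ v)))

    defect-swap : ∀ N L y z → (∀ v → ∂ L v ≡ single z v xor single y v) →
      ∀ v → defect (N ⊻ L) v ≡ defect N v xor (single z v xor single y v)
    defect-swap N L y z bd v = trans (∂-⊻ (N ⊻ L) Mₒ v) (trans (cong (_xor ∂ Mₒ v) (∂-⊻ N L v))
      (trans (cong (λ l → (∂ N v xor l) xor ∂ Mₒ v) (bd v))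
        (trans (solve 4 (λ n o y z → (n :+ (z :+ y)) :+ o := (n :+ o) :+ (z :+ y))
             refl (∂ N v) (∂ Mₒ v) (single y v) (single z v))
          (cong (_xor _) (sym (∂-⊻ N Mₒ v))))))

    ∂-Mₒ⊻ : ∀ L y z → (∀ v → ∂ L v ≡ single z v xor single y v) →
      ∀ v → ∂ (Mₒ ⊻ L) v ≡ ∂ Mₒ v xor (single z v xor single y v)
    ∂-Mₒ⊻ L y z bd v = trans (∂-⊻ Mₒ L v) (cong (∂ Mₒ v xor_) (bd v))

    -- Toggling `L` removes the defect at `z` and creates none, its other end `y` being a defect
    -- already.
    swap-support : ∀ N L y z → y ≢ z → defect N y ≡ true → defect N z ≡ true →
      (∀ v → ∂ L v ≡ single z v xor single y v) →
      ∀ v → defect (N ⊻ L) v ≡ true → v ≢ z × defect N v ≡ true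
    swap-support N L y z y≢z dy dz bd v h = v≢z v h , dv
      where
      v≢z : ∀ v → defect (N ⊻ L) v ≡ true → v ≢ z
      v≢z v h refl = true≢false (trans (sym h) (trans (defect-swap N L y v bd v)
        (cong₂ _xor_ dz (cong₂ _xor_ (⌊⌋-true {x = v} refl) (⌊⌋-false y≢z)))))
      dv : defect N v ≡ true
      dv with v ≟ y
      ... | yes refl = dy
      ... | no v≢y = trans (sym (xor-identityʳ _)) (trans
              (cong (defect N v xor_) (sym (cong₂ _xor_ (⌊⌋-false (v≢z v h ∘ sym)) (⌊⌋-false (v≢y ∘ sym)))))
              (trans (sym (defect-swap N L y z bd v)) h))

    even-defect : ∀ N → (∀ v → defect N v ≡ true → Neighbour v) → m ≤ cost c N
    even-defect N nb = go (count (defect N)) N ℕₚ.≤-refl nb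
      where
      go : ∀ k N → count (defect N) ≤ k → (∀ v → defect N v ≡ true → Neighbour v) → m ≤ cost c N
      go k N le nb with any? (λ v → defect N v Data.Bool.≟ true)
      ... | no none = lift-even N λ v → trans (defect≡ N v)
              (trans (cong (∂ Mₒ v xor_) (≢true⇒≡false λ h → none (v , h))) (xor-identityʳ _))
      ... | yes (z , dz) with y , L , y≢z , dy , L⊑ , bd ← subpath (N ⊻ Mₒ) (inside-⊤ _) z dz = descend k le
        where
        J = lift-odd (Mₒ ⊻ L) z y (nb z dz) (∂-Mₒ⊻ L y z bd)
        -- The lift is a join at the neighbour `y`, where parity demands `m + 1`; the edge used for
        -- lifting accounts for the 1.
        m≤ : m ≤ cost c (Mₒ ⊻ L)
        m≤ = ℕ.s≤s⁻¹ (ℕₚ.≤-trans (neighbour-dear y (nb y dy) (proj₁ J) (proj₁ (proj₂ J)))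
               (ℕₚ.≤-trans (proj₂ (proj₂ J)) (ℕₚ.≤-reflexive (ℕₚ.+-comm _ 1))))
        cheaper : cost c (N ⊻ L) ≤ cost c N
        cheaper = ℕₚ.+-cancelʳ-≤ m _ _ (begin
          cost c (N ⊻ L) + m                    ≤⟨ ℕₚ.+-monoʳ-≤ (cost c (N ⊻ L)) m≤ ⟩
          cost c (N ⊻ L) + cost c (Mₒ ⊻ L)      ≡⟨ cost-exchange c L N Mₒ L⊑ ⟩
          cost c N + cost c Mₒ                  ≤⟨ ℕₚ.+-monoʳ-≤ (cost c N) cost-Mₒ ⟩
          cost c N + m                          ∎)
          where open ℕₚ.≤-Reasoning
        support = swap-support N L y z y≢z dy dz bd
        fewer : count (defect (N ⊻ L)) < count (defect N)
        fewer = count-strict (defect (N ⊻ L)) (defect N) z (λ v h → proj₂ (support v h))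
                  (≢true⇒≡false λ h → proj₁ (support z h) refl) dz
        descend : ∀ k → count (defect N) ≤ k → m ≤ cost c N
        descend zero    le = contradiction (ℕₚ.<-≤-trans fewer le) λ ()
        descend (suc k) le = ℕₚ.≤-trans
          (go k (N ⊻ L) (ℕ.s≤s⁻¹ (ℕₚ.<-≤-trans fewer le)) λ v h → nb v (proj₂ (support v h))) cheaper

    odd-defect : ∀ N u h → (∀ J → JoinAt u J → h ≤ cost c J) → defect N u ≡ true →
      (∀ v → v ≢ u → defect N v ≡ true → Neighbour v) → h ≤ cost c N + 1
    odd-defect N u h dear du nb with y , L , y≢u , dy , L⊑ , bd ← subpath (N ⊻ Mₒ) (inside-⊤ _) u du =
      ℕₚ.+-cancelˡ-≤ m _ _ (begin
        m + h                                        ≤⟨ ℕₚ.+-mono-≤ m≤ h≤ ⟩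
        cost c (N ⊻ L) + (cost c (Mₒ ⊻ L) + 1)       ≡⟨ ℕₚ.+-assoc (cost c (N ⊻ L)) _ 1 ⟨
        (cost c (N ⊻ L) + cost c (Mₒ ⊻ L)) + 1       ≡⟨ cong (_+ 1) (cost-exchange c L N Mₒ L⊑) ⟩
        (cost c N + cost c Mₒ) + 1                   ≤⟨ ℕₚ.+-monoˡ-≤ 1 (ℕₚ.+-monoʳ-≤ (cost c N) cost-Mₒ) ⟩
        (cost c N + m) + 1                           ≡⟨ cong (_+ 1) (ℕₚ.+-comm (cost c N) m) ⟩
        (m + cost c N) + 1                           ≡⟨ ℕₚ.+-assoc m (cost c N) 1 ⟩
        m + (cost c N + 1)                           ∎)
      where
      open ℕₚ.≤-Reasoning
      J = lift-odd (Mₒ ⊻ L) y u (nb y y≢u dy) λ v →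
            trans (∂-Mₒ⊻ L y u bd v) (cong (∂ Mₒ v xor_) (xor-comm (single u v) (single y v)))
      h≤ : h ≤ cost c (Mₒ ⊻ L) + 1
      h≤ = ℕₚ.≤-trans (dear (proj₁ J) (proj₁ (proj₂ J))) (proj₂ (proj₂ J))
      -- Toggling `L` has removed the defect at `u`, so all remaining defects are neighbours.
      m≤ : m ≤ cost c (N ⊻ L)
      m≤ = even-defect (N ⊻ L) λ v dv →
        let v≢u , dv' = swap-support N L y u y≢u dy du bd v dv in nb v v≢u dv'

    c* : E → Bool
    c* e = c e ∧ not (cross e)

    cost-outer : ∀ J → cost c (J ⊓ outer) ≤ cost c* J
    cost-outer J = count-mono ((J ⊓ outer) ⊓ c) (J ⊓ c*) λ e → pointwise (J e) (C (P e)) (C (Q e)) (c e)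
      where
      pointwise : ∀ j a b d → (j ∧ (not a ∧ not b)) ∧ d ≡ true → j ∧ (d ∧ not (a xor b)) ≡ true
      pointwise true false false true h = refl

    -- Keep only the part `N` of `J` outside `C`. Its defects other than `u` are vertices where `J`
    -- enters `C` an odd number of times, hence neighbours of `C`.
    contracted-lower : ∀ u h → C u ≡ false → (∀ J → JoinAt u J → h ≤ cost c J) →
      ∀ J → JoinAt u J → h ≤ cost c* J + 1
    contracted-lower u h u∉ dear J join = ℕₚ.≤-trans bound (ℕₚ.+-monoˡ-≤ 1 (cost-outer J))
      where
      N = J ⊓ outer
      defect-outer : ∀ v → C v ≡ false → defect N v ≡ single u v xor ∂ (J ⊓ cross) v
      defect-outer v v∉ = begin
        defect N v                                                     ≡⟨ ∂-⊻ N Mₒ v ⟩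
        ∂ N v xor ∂ Mₒ v
          ≡⟨ solve 3 (λ n o k → n :+ o := (n :+ k) :+ (k :+ o)) refl (∂ N v) (∂ Mₒ v) (∂ (J ⊓ cross) v) ⟩
        (∂ N v xor ∂ (J ⊓ cross) v) xor (∂ (J ⊓ cross) v xor ∂ Mₒ v)
          ≡⟨ cong₂ _xor_ (trans (sym (∂-at-outer J v v∉)) (join v)) (cong (∂ (J ⊓ cross) v xor_) ∂Mₒ) ⟩
        (T v xor single u v) xor (∂ (J ⊓ cross) v xor T v)
          ≡⟨ solve 3 (λ t u k → (t :+ u) :+ (k :+ t) := u :+ k) refl (T v) (single u v) (∂ (J ⊓ cross) v) ⟩
        single u v xor ∂ (J ⊓ cross) v                                 ∎
        where
        open ≡-Reasoning
        v≢b : b ≢ v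
        v≢b refl = true≢false (trans (sym b∈C) v∉)
        ∂Mₒ : ∂ Mₒ v ≡ T v
        ∂Mₒ = trans (sym (xor-identityʳ _)) (trans (cong (∂ Mₒ v xor_) (sym (∂-inner M v v∉)))
          (trans (∂-MᵢMₒ v) (trans (cong (T v xor_) (⌊⌋-false v≢b)) (xor-identityʳ _))))
      defect-inner : ∀ v → C v ≡ true → defect N v ≡ false
      defect-inner v v∈ = trans (∂-⊻ N Mₒ v) (cong₂ _xor_ (∂-outer J v v∈) (∂-outer M v v∈))
      nb : ∀ v → v ≢ u → defect N v ≡ true → Neighbour v
      nb v v≢u dv = ∂-cross⇒neighbour J v v∉
        (trans (sym (trans (defect-outer v v∉) (cong (_xor ∂ (J ⊓ cross) v) (⌊⌋-false (v≢u ∘ sym))))) dv)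
        where
        v∉ : C v ≡ false
        v∉ = ≢true⇒≡false λ v∈ → true≢false (trans (sym dv) (defect-inner v v∈))
      h≤m+1 : Neighbour u → h ≤ m + 1
      h≤m+1 (e , x , j , x∈ , cr) = let J' , join' , le = toggle-edge {e} j x∈ in
        ℕₚ.≤-trans (dear J' join') (ℕₚ.≤-trans le (ℕₚ.≤-trans (cost-⊻ c M (single e))
          (ℕₚ.≤-reflexive (cong (m +_) (trans (cost-single c e) (cong ⟦_⟧ (cross⇒c e cr)))))))
      u-neighbour : defect N u ≡ false → Neighbour u
      u-neighbour du = ∂-cross⇒neighbour J u u∉
        (unnegate (trans (sym (trans (defect-outer u u∉) (cong (_xor ∂ (J ⊓ cross) u) (⌊⌋-true {x = u} refl)))) du))
        where
        unnegate : ∀ {k} → true xor k ≡ false → k ≡ true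
        unnegate {true} _ = refl
      bound : h ≤ cost c N + 1
      bound with defect N u Data.Bool.≟ true
      ... | yes du = odd-defect N u h dear du nb
      -- If `u` is no defect, an odd number of edges of `J` must run from `u` into `C`; then `u` is
      -- a neighbour, and moving the terminal of `M` there costs at most 1.
      ... | no ¬du = ℕₚ.≤-trans (h≤m+1 (u-neighbour (≢true⇒≡false ¬du)))
                       (ℕₚ.+-monoˡ-≤ 1 (even-defect N λ v dv → nb v (λ { refl → ¬du dv }) dv))

    -- |C ∩ T| is odd, so a join of T Δ X with X disjoint from C meets δ(C).
    crosses : ∀ (X : V → Bool) → (∀ v → C v ≡ true → X v ≡ false) → ∀ J → (∀ v → ∂ J v ≡ T v xor X v) →
      ∃ λ e → J e ≡ true × cross e ≡ true
    crosses X disj J bd with any? (λ e → (J e ∧ cross e) Data.Bool.≟ true)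
    ... | yes (e , h) = e , ∧-trueˡ {J e} h , ∧-trueʳ {J e} h
    ... | no none = contradiction (trans (sym ∂y) (trans (∂K y) (⌊⌋-false (y≢b ∘ sym)))) true≢false
      where
      free : ∀ e → (J ⊻ M) e ≡ true → cross e ≡ false
      free e h with J e in j | M e in k
      ... | true  | false = ≢true⇒≡false λ cr → none (e , ∧-intro j cr)
      ... | false | true  = M-uncrossed e k
      -- If neither `J` nor `M` meets δ(C), `b` is the only odd vertex of this set, which is
      -- impossible.
      K = (J ⊻ M) ⊓ inner
      ∂K : ∀ v → ∂ K v ≡ single b v
      ∂K v with C v in v∈?
      ... | false = trans (∂-inner (J ⊻ M) v v∈?) (sym (⌊⌋-false λ { refl → true≢false (trans (sym b∈C) v∈?) }))
      ... | true  = begin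
        ∂ K v
          ≡⟨ trans (sym (xor-identityʳ _)) (cong (∂ K v xor_) (sym (∂-cross-free (J ⊻ M) free v))) ⟩
        ∂ K v xor ∂ ((J ⊻ M) ⊓ cross) v             ≡⟨ ∂-at-inner (J ⊻ M) v v∈? ⟨
        ∂ (J ⊻ M) v                                 ≡⟨ ∂-⊻ J M v ⟩
        ∂ J v xor ∂ M v
          ≡⟨ cong₂ _xor_ (trans (bd v) (cong (T v xor_) (disj v v∈?))) (M-join v) ⟩
        (T v xor false) xor (T v xor single b v)    ≡⟨ cong (_xor (T v xor single b v)) (xor-identityʳ (T v)) ⟩
        T v xor (T v xor single b v)                ≡⟨ solve 2 (λ t b → t :+ (t :+ b) := b) refl (T v) (single b v) ⟩
        single b v                                  ∎
        where open ≡-Reasoning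
      found = subpath K (inside-⊤ K) b (trans (∂K b) (⌊⌋-true {x = b} refl))
      y = proj₁ found
      y≢b = proj₁ (proj₂ (proj₂ found))
      ∂y = proj₁ (proj₂ (proj₂ (proj₂ found)))

    contracted-upper : ∀ (X : V → Bool) → (∀ v → C v ≡ true → X v ≡ false) → ∀ J → (∀ v → ∂ J v ≡ T v xor X v) →
      suc (cost c* J) ≤ cost c J
    contracted-upper X disj J bd with e , j , cr ← crosses X disj J bd =
      count-strict (J ⊓ c*) (J ⊓ c) e
        (λ i h → ∧-intro (∧-trueˡ {J i} h) (∧-trueˡ {c i} (∧-trueʳ {J i} h)))
        (≢true⇒≡false λ h → true≢false (trans (sym (∧-trueʳ {c e} (∧-trueʳ {J e} h))) (cong not cr)))
        (∧-intro j (cross⇒c e cr))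

    -- All edges of δ(C) cost 1, so freeing them amounts to adding the coboundary of `C` modulo 2.
    pot* : ∀ e → c* e ≡ (p ⊻ C) (P e) xor (p ⊻ C) (Q e)
    pot* e = trans (pointwise (c e) (cross e) (cross⇒c e)) (trans (cong (_xor cross e) (pot e))
      (solve 4 (λ p q a b → (p :+ q) :+ (a :+ b) := (p :+ a) :+ (q :+ b)) refl (p (P e)) (p (Q e)) (C (P e)) (C (Q e))))
      where
      pointwise : ∀ d k → (k ≡ true → d ≡ true) → d ∧ not k ≡ d xor k
      pointwise false false _ = refl
      pointwise false true  h = contradiction (sym (h refl)) true≢false
      pointwise true  false _ = refl
      pointwise true  true  _ = refl

  -- The lower bound for arbitrary sets of contact vertices.

  AtMost : (E → Bool) → ℕ → V → Set
  AtMost c n u = ∃ λ J → JoinAt u J × cost c J ≤ n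

  -- Induction on `n`, which drops by one with each contraction. `near` is what remains of
  -- primality, demanded only where edges still cost; `dear` expresses that `X` lies in A(r); `J₀`
  -- gives the search for a minimiser its starting point.
  cost-lower : ∀ n (c : E → Bool) (p : V → Bool) → (∀ e → c e ≡ p (P e) xor p (Q e)) →
    (∀ e → c e ≡ true → AtMost c n (P e) × AtMost c n (Q e)) →
    ∀ r J₀ → JoinAt r J₀ →
    ∀ (X : V → Bool) → (∀ x → X x ≡ true → ∀ J → JoinAt x J → n ≤ cost c J) →
    ∀ J → (∀ v → ∂ J v ≡ T v xor X v) → n ≤ cost c J
  cost-lower zero c p pot near r J₀ join₀ X dear J bd = z≤n
  cost-lower (suc n) c p pot near r J₀ join₀ X dear J bd
    with (b , M , M-join) , M-min ← minimise {∃ λ u → ∃ λ J → JoinAt u J} (λ (_ , J , _) → cost c J)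
           (λ k → map′ (λ (u , J , join , lt) → (u , J , join) , lt) (λ ((u , J , join) , lt) → u , J , join , lt)
              (any? λ u → anyFunction?
                (λ {J} {K} eq (join , lt) → (λ v → trans (sym (∂-cong J K eq v)) (join v)) ,
                                              subst (_< k) (cost-cong c J K eq) lt)
                λ J → joinAt? u J ×-dec (cost c J ℕ.<? k)))
           (r , J₀ , join₀)
    with suc n ℕ.≤? cost c M
  -- Here h equals `suc n` at both ends of every costly edge, which parity forbids. So no edge costs
  -- anything, and `suc n` is at most the cost of `M`, which is 0.
  ... | yes n≤m = ℕₚ.≤-trans n≤m (ℕₚ.≤-trans (ℕₚ.≤-reflexive
          (∑.sum-zero (λ e → ⟦ M e ∧ c e ⟧) λ e → cong ⟦_⟧ (≢true⇒≡false λ h → flat e (∧-trueʳ {M e} h)))) z≤n)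
    where
    open Potential c p pot
    level : ∀ u → AtMost c (suc n) u → odd? (suc n) ≡ ⊕.sum (λ v → p v ∧ T v) xor p u
    level u (J , join , le) = trans
      (cong odd? (ℕₚ.≤-antisym (ℕₚ.≤-trans n≤m (M-min (u , J , join))) le)) (odd?-joinAt J join)
    flat : ∀ e → c e ≢ true
    flat e ce = true≢false (trans (sym ce) (trans (pot e)
      (trans (solve 3 (λ t x y → x :+ y := (t :+ x) :+ (t :+ y)) refl (⊕.sum (λ v → p v ∧ T v)) (p (P e)) (p (Q e)))
        (trans (cong₂ _xor_ (sym (level (P e) (proj₁ (near e ce)))) (sym (level (Q e) (proj₂ (near e ce)))))
          (xor-same (odd? (suc n)))))))
  ... | no n≰m with C , C⇒path , path⇒C ← freeBall c b = ℕₚ.≤-trans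
      (s≤s (cost-lower n c* (p ⊻ C) pot* near* r J₀ join₀ X dear* J bd))
      (contracted-upper X disj J bd)
    where
    open Step c p pot b M M-join (λ u J join → M-min (u , J , join)) C C⇒path path⇒C
    open Split C
    -- All vertices of `C` admit joins of cost at most `m`, too cheap for a vertex of `X`.
    disj : ∀ v → C v ≡ true → X v ≡ false
    disj v v∈ = ≢true⇒≡false λ Xv → let J , join , le = joinAt-near v v∈ in
      n≰m (ℕₚ.≤-trans (dear v Xv J join) le)
    dear* : ∀ x → X x ≡ true → ∀ J → JoinAt x J → n ≤ cost c* J
    dear* x Xx J join = ℕ.s≤s⁻¹ (ℕₚ.≤-trans
      (contracted-lower x (suc n) (≢true⇒≡false λ x∈ → true≢false (trans (sym Xx) (disj x x∈))) (dear x Xx) J join)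
      (ℕₚ.≤-reflexive (ℕₚ.+-comm _ 1)))
    drop : ∀ u → C u ≡ false → AtMost c (suc n) u → AtMost c* n u
    drop u u∉ (J , join , le) = J , join , ℕ.s≤s⁻¹ (ℕₚ.≤-trans
      (contracted-upper (single u) (λ v v∈ → ⌊⌋-false λ { refl → true≢false (trans (sym v∈) u∉) }) J join) le)
    near* : ∀ e → c* e ≡ true → AtMost c* n (P e) × AtMost c* n (Q e)
    near* e h = drop (P e) (proj₁ outside) (proj₁ (near e ce)) , drop (Q e) (proj₂ outside) (proj₂ (near e ce))
      where
      ce = ∧-trueˡ {c e} h
      -- An edge that still costs neither crosses δ(C) nor lies inside `C`, where edges are free.
      outside : C (P e) ≡ false × C (Q e) ≡ false
      outside with C (P e) in a | C (Q e) in b | not-true (∧-trueʳ {c e} h)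
      ... | false | false | _ = refl , refl
      ... | true  | true  | _ = contradiction (trans (sym ce) (inner⇒¬c e a b)) true≢false

-- From subsets, degrees and parities to boundaries.

∈⇒true : ∀ {n x} {S : Subset n} → x ∈ S → lookup S x ≡ true
∈⇒true = []=⇒lookup

true⇒∈ : ∀ {n} {x} {S : Subset n} → lookup S x ≡ true → x ∈ S
true⇒∈ {x = x} {S} = lookup⇒[]= x S

∉⇒false : ∀ {n} {x} {S : Subset n} → x ∉ S → lookup S x ≡ false
∉⇒false x∉ = ≢true⇒≡false λ h → x∉ (true⇒∈ h)

bool-ext : ∀ {a b} → (a ≡ true → b ≡ true) → (b ≡ true → a ≡ true) → a ≡ b
bool-ext {true}          f g = sym (f refl)
bool-ext {false} {false} f g = refl
bool-ext {false} {true}  f g = g refl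

∣∣≡count : ∀ {n} (S : Subset n) → ∣ S ∣ ≡ count (lookup S)
∣∣≡count []          = refl
∣∣≡count (true  ∷ S) = cong suc (∣∣≡count S)
∣∣≡count (false ∷ S) = ∣∣≡count S

∣tabulate∣ : ∀ {n} (J : Fin n → Bool) → ∣ tabulate J ∣ ≡ count J
∣tabulate∣ J = trans (∣∣≡count (tabulate J)) (count-cong (lookup (tabulate J)) J (lookup∘tabulate J))

Odd⇒odd? : ∀ n → Odd n → odd? n ≡ true
Odd⇒odd? 1             _ = refl
Odd⇒odd? (suc (suc n)) h rewrite Odd⇒odd? n h = refl

odd?⇒Odd : ∀ n → odd? n ≡ true → Odd n
odd?⇒Odd 1             _ = refl
odd?⇒Odd (suc (suc n)) h with odd? n in eq
... | true = odd?⇒Odd n eq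

lookup-⁅⁆ : ∀ {n} (x v : Fin n) → lookup ⁅ x ⁆ v ≡ single x v
lookup-⁅⁆ x v = bool-ext (λ h → ⌊⌋-true (sym (x∈⁅y⁆⇒x≡y x (true⇒∈ h))))
                         (λ h → subst (λ y → lookup ⁅ x ⁆ y ≡ true) (⌊⌋-sound h) (∈⇒true (x∈⁅x⁆ x)))

lookup-Δ : ∀ {n} (S R : Subset n) v → lookup (S Δ R) v ≡ lookup S v xor lookup R v
lookup-Δ S R v = lookup-zipWith _xor_ v S R

lookup-∩ : ∀ {n} (S R : Subset n) v → lookup (S ∩ R) v ≡ lookup S v ∧ lookup R v
lookup-∩ S R v = lookup-zipWith _∧_ v S R

count-one : ∀ {n} (J : Fin n → Bool) → count J ≡ 1 →
  ∃ λ e → J e ≡ true × (∀ e' → J e' ≡ true → e' ≡ e)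
count-one J one with any? (λ e → J e Data.Bool.≟ true)
... | no none = contradiction (trans (sym one)
        (∑.sum-zero (⟦_⟧ ∘ J) λ e → cong ⟦_⟧ (≢true⇒≡false λ h → none (e , h)))) λ ()
... | yes (e , j) = e , j , unique
  where
  unique : ∀ e' → J e' ≡ true → e' ≡ e
  unique e' j' with e' ≟ e
  ... | yes eq = eq
  ... | no ne  = contradiction (subst₂ _<_ (count-single e) one
          (count-strict (single e) J e' (single-⊑ J j) (⌊⌋-false (ne ∘ sym)) j')) (ℕₚ.<-irrefl refl)

count-exchange : ∀ {n} (S J K : Fin n → Bool) → S ⊑ (J ⊻ K) →
  count (J ⊻ S) + count (K ⊻ S) ≡ count J + count K
count-exchange S J K sub = trans (sym (cong₂ _+_ (unit (J ⊻ S)) (unit (K ⊻ S))))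
  (trans (cost-exchange (λ _ → true) S J K sub) (cong₂ _+_ (unit J) (unit K)))
  where
  unit : ∀ L → cost (λ _ → true) L ≡ count L
  unit L = count-cong (L ⊓ (λ _ → true)) L λ e → ∧-identityʳ (L e)

bipartition⇒loopless : ∀ g {A B} → IsBipartition g ⊤ A B → ∀ e → proj₁ (ends g e) ≢ proj₂ (ends g e)
bipartition⇒loopless g {A} {B} (_ , disj , edge) e eq with edge e ∈⊤ ∈⊤
... | inj₁ (p∈A , q∈B) = disj _ (p∈A , subst (_∈ B) (sym eq) q∈B)
... | inj₂ (p∈B , q∈A) = disj _ (subst (_∈ A) (sym eq) q∈A , p∈B)

module Loopless (g : Graph) (loopless : ∀ e → proj₁ (ends g e) ≢ proj₂ (ends g e)) where
  open Boundary g

  private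
    E = Fin (nE g)
    V = Fin (nV g)

  -- The `∨` in `isEnd` and the `xor` in `inc` differ only on loops.
  isEnd≡inc : ∀ v e → isEnd g v e ≡ inc e v
  isEnd≡inc v e with P e ≟ v | Q e ≟ v
  ... | yes p | yes q = contradiction (trans p (sym q)) (loopless e)
  ... | yes _ | no _  = refl
  ... | no _  | yes _ = refl
  ... | no _  | no _  = refl

  IsEnd⇒inc : ∀ v e → IsEnd g v e → inc e v ≡ true
  IsEnd⇒inc v e end = trans (sym (isEnd≡inc v e)) (decide end)
    where
    decide : IsEnd g v e → isEnd g v e ≡ true
    decide end with P e ≟ v | Q e ≟ v
    decide end      | yes _ | _     = refl
    decide end      | no _  | yes _ = refl
    decide (inj₁ p) | no ¬p | no _  = contradiction p ¬p
    decide (inj₂ q) | no _  | no ¬q = contradiction q ¬q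

  deg≡count : ∀ F v → deg g F v ≡ count (λ e → lookup F e ∧ inc e v)
  deg≡count F v = trans (∣∣≡count (F ∩ star g v)) (count-cong (lookup (F ∩ star g v)) _ λ e →
    trans (lookup-∩ F (star g v) e) (cong (lookup F e ∧_) (trans (lookup∘tabulate (isEnd g v) e) (isEnd≡inc v e))))

  odd?-deg : ∀ F v → odd? (deg g F v) ≡ ∂ (lookup F) v
  odd?-deg F v = trans (cong odd? (deg≡count F v)) (odd?-count (λ e → lookup F e ∧ inc e v))

  JoinIn : Subset (nV g) → (V → Bool) → (E → Bool) → Set
  JoinIn U T J = WalkSets.Inside g U J × (∀ v → v ∈ U → ∂ J v ≡ T v)

  JoinIn-cong : ∀ {U T J K} → (∀ e → J e ≡ K e) → JoinIn U T J → JoinIn U T K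
  JoinIn-cong {J = J} {K} eq (ins , bd) =
    (λ e h → ins e (trans (eq e) h)) , λ v v∈ → trans (sym (∂-cong J K eq v)) (bd v v∈)

  isJoinIn⇒ : ∀ {U T F} → IsJoinIn g U T F → JoinIn U (lookup T) (lookup F)
  isJoinIn⇒ {U} {T} {F} (ins , par) = (λ e h → ins e (true⇒∈ h)) , λ v v∈ → trans (sym (odd?-deg F v))
    (bool-ext (λ h → ∈⇒true (to (par v v∈) (odd?⇒Odd (deg g F v) h)))
              (λ h → Odd⇒odd? (deg g F v) (from (par v v∈) (true⇒∈ h))))

  isJoinIn⇐ : ∀ {U T F} → JoinIn U (lookup T) (lookup F) → IsJoinIn g U T F
  isJoinIn⇐ {U} {T} {F} (ins , bd) = (λ e h → ins e (∈⇒true h)) , λ v v∈ → mk⇔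
    (λ h → true⇒∈ (trans (sym (trans (odd?-deg F v) (bd v v∈))) (Odd⇒odd? (deg g F v) h)))
    (λ h → odd?⇒Odd (deg g F v) (trans (trans (odd?-deg F v) (bd v v∈)) (∈⇒true h)))

  MinJoinIn : Subset (nV g) → (V → Bool) → (E → Bool) → Set
  MinJoinIn U T J = JoinIn U T J × (∀ K → JoinIn U T K → count J ≤ count K)

  isMinJoinIn⇒ : ∀ {U T F} → IsMinJoinIn g U T F → MinJoinIn U (lookup T) (lookup F)
  isMinJoinIn⇒ {U} {T} {F} (join , least) = isJoinIn⇒ join , λ K joinK →
    subst₂ _≤_ (∣∣≡count F) (∣tabulate∣ K)
      (least (tabulate K) (isJoinIn⇐ (JoinIn-cong (sym ∘ lookup∘tabulate K) joinK)))

  isMinJoinIn⇐ : ∀ {U T F} → MinJoinIn U (lookup T) (lookup F) → IsMinJoinIn g U T F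
  isMinJoinIn⇐ {U} {T} {F} (join , least) = isJoinIn⇐ join , λ K joinK →
    subst₂ _≤_ (sym (∣∣≡count F)) (sym (∣∣≡count K)) (least (lookup K) (isJoinIn⇒ joinK))

  MinJoinIn-cong : ∀ {U T J K} → (∀ e → J e ≡ K e) → MinJoinIn U T J → MinJoinIn U T K
  MinJoinIn-cong {J = J} {K} eq (join , least) = JoinIn-cong eq join ,
    λ L joinL → subst (_≤ count L) (count-cong J K eq) (least L joinL)

  JoinIn-target : ∀ {U T S J} → (∀ v → T v ≡ S v) → JoinIn U T J → JoinIn U S J
  JoinIn-target eq (ins , bd) = ins , λ v v∈ → trans (bd v v∈) (eq v)

  joinIn? : ∀ U T J → Dec (JoinIn U T J)
  joinIn? U T J = inside? ×-dec boundary?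
    where
    inside? = all? λ e → (J e Data.Bool.≟ true) →-dec ((P e ∈? U) ×-dec (Q e ∈? U))
    boundary? = all? λ v → (v ∈? U) →-dec (∂ J v Data.Bool.≟ T v)

  leastJoin : ∀ {U T J} → JoinIn U T J → ∃ (MinJoinIn U T)
  leastJoin {U} {T} {J} join =
    let (K , joinK) , least = minimise {∃ (JoinIn U T)} (count ∘ proj₁) search (J , join)
    in K , joinK , λ L joinL → least (L , joinL)
    where
    search : ∀ k → Dec (∃ λ (a : ∃ (JoinIn U T)) → count (proj₁ a) < k)
    search k = map′ (λ (K , joinK , lt) → (K , joinK) , lt) (λ ((K , joinK) , lt) → K , joinK , lt)
      (anyFunction? (λ {K} {L} eq (joinK , lt) → JoinIn-cong eq joinK , subst (_< k) (count-cong K L eq) lt)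
                    λ K → joinIn? U T K ×-dec (count K ℕ.<? k))

-- Edges leaving U are turned into loops, so that the joins of g[U] are boundaries in one graph.
module Localise (g : Graph) (U : Subset (nV g)) where
  open Boundary g
  open WalkSets g U using (Inside)

  inU : Fin (nE g) → Bool
  inU e = lookup U (P e) ∧ lookup U (Q e)

  localised : Graph
  localised = record { nV = nV g ; nE = nE g ; ends = λ e → P e , (if inU e then Q e else P e) }

  module L = Boundary localised

  ∂-localised : ∀ J v → L.∂ J v ≡ ∂ (J ⊓ inU) v
  ∂-localised J v = ⊕.sum-cong-≗ λ e → pointwise e (inU e)
    where
    pointwise : ∀ e b → J e ∧ (single (P e) v xor single (if b then Q e else P e) v) ≡ (J e ∧ b) ∧ inc e v
    pointwise e true  = cong (_∧ inc e v) (sym (∧-identityʳ (J e)))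
    pointwise e false = trans (cong (J e ∧_) (xor-same (single (P e) v)))
      (trans (∧-zeroʳ (J e)) (sym (cong (_∧ inc e v) (∧-zeroʳ (J e)))))

  inside-⊓ : ∀ J → Inside (J ⊓ inU)
  inside-⊓ J e h = let i = ∧-trueʳ {J e} h in
    true⇒∈ (∧-trueˡ {lookup U (P e)} i) , true⇒∈ (∧-trueʳ {lookup U (P e)} i)

  inside-≡ : ∀ {J} → Inside J → ∀ e → (J ⊓ inU) e ≡ J e
  inside-≡ {J} ins e = bool-ext (∧-trueˡ {J e}) λ h →
    let p , q = ins e h in ∧-intro h (∧-intro (∈⇒true p) (∈⇒true q))

  ∂-inside : ∀ {J} → Inside J → ∀ v → L.∂ J v ≡ ∂ J v
  ∂-inside {J} ins v = trans (∂-localised J v) (∂-cong (J ⊓ inU) J (inside-≡ ins) v)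

  ∂-outside : ∀ {J} → Inside J → ∀ v → v ∉ U → ∂ J v ≡ false
  ∂-outside {J} ins v v∉ = ∂-avoid J v λ e h →
    (λ { refl → v∉ (proj₁ (ins e h)) }) , (λ { refl → v∉ (proj₂ (ins e h)) })

-- Tooth grafts: the number n_v and its attainment.

module Tooth (g : Graph) (loopless : ∀ e → proj₁ (ends g e) ≢ proj₂ (ends g e))
  (U A B : Subset (nV g)) (bip : IsBipartition g U A B)
  (Tt : Subset (nV g)) (r : Fin (nV g)) (r∈U : r ∈ U)
  (Tt⊆U : ∀ v → v ∈ Tt → v ∈ U) (primal : Primal g U Tt r) where

  open Boundary g
  open WalkSets g U
  open Loopless g loopless
  open Localise g U

  private
    E = Fin (nE g)
    V = Fin (nV g)

  T' : V → Bool
  T' v = lookup Tt v xor single r v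

  F₀ : Subset (nE g)
  F₀ = proj₁ (proj₁ primal)

  F₀-min : IsMinJoinIn g U Tt F₀
  F₀-min = proj₂ (proj₁ primal)

  F₀-inside : Inside (lookup F₀)
  F₀-inside = proj₁ (proj₁ (isMinJoinIn⇒ F₀-min))

  size : ℕ
  size = count (lookup F₀)

  outside-Tt : ∀ v → v ∉ U → lookup Tt v ≡ false
  outside-Tt v v∉ = ∉⇒false λ v∈ → v∉ (Tt⊆U v v∈)

  ∂F₀ : ∀ v → ∂ (lookup F₀) v ≡ lookup Tt v
  ∂F₀ v with v ∈? U
  ... | yes v∈ = proj₂ (proj₁ (isMinJoinIn⇒ F₀-min)) v v∈
  ... | no v∉  = trans (∂-outside F₀-inside v v∉) (sym (outside-Tt v v∉))

  walk-inside : ∀ {x y} (w : Walk g U x y) e → edgeSet w e ≡ true → P e ∈ U × Q e ∈ U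
  walk-inside (cons e j x∈ w) e' h with single e e' in eq
  ... | false = walk-inside w e' h
  ... | true with refl ← ⌊⌋-sound eq = end j
    where
    start∈ : ∀ {x y} → Walk g U x y → x ∈ U
    start∈ (nil x∈)        = x∈
    start∈ (cons _ _ x∈ _) = x∈
    end : Joins g e _ _ → P e ∈ U × Q e ∈ U
    end (inj₁ refl) = x∈ , start∈ w
    end (inj₂ refl) = start∈ w , x∈

  -- Toggling a path from `r` in `F₀` changes the size by the weight of the path; this converts
  -- distances from `r` into bounds on h.
  alongPath : ∀ {x} (w : Path g U r x) → Inside (lookup F₀ ⊻ edgeSet (proj₁ w)) ×
    (∀ v → ∂ (lookup F₀ ⊻ edgeSet (proj₁ w)) v ≡ T' v xor single x v) ×
    ⁺ count (lookup F₀ ⊻ edgeSet (proj₁ w)) ≡ weight g U F₀ w ℤ.+ ⁺ size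
  alongPath {x} (w , uniq) = ins , bd , path-count F₀ w uniq
    where
    ins : Inside (lookup F₀ ⊻ edgeSet w)
    ins e h with lookup F₀ e in f | edgeSet w e in s
    ... | true  | _    = F₀-inside e f
    ... | false | true = walk-inside w e s
    bd : ∀ v → ∂ (lookup F₀ ⊻ edgeSet w) v ≡ T' v xor single x v
    bd v = trans (∂-⊻ (lookup F₀) (edgeSet w) v)
      (trans (cong₂ _xor_ (∂F₀ v) (∂-edgeSet w v)) (sym (xor-assoc (lookup Tt v) (single r v) (single x v))))

  private
    module C = JoinsAt localised T'

  joinAt : ∀ {x J} → Inside J → (∀ v → ∂ J v ≡ T' v xor single x v) → C.JoinAt x J
  joinAt ins bd v = trans (∂-inside ins v) (bd v)

  reach : ∀ x → x ∈ U → C.AtMost inU size x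
  reach x x∈ = along (proj₂ primal F₀ F₀-min x x∈)
    where
    along : (∃ λ k → IsLambda g U F₀ r x k × (k ℤ.≤ ⁺ 0)) → C.AtMost inU size x
    along (k , ((w , weight≡) , _) , k≤0) = K , joinAt (proj₁ (alongPath w)) (proj₁ (proj₂ (alongPath w))) ,
      ℕₚ.≤-trans (count-mono (K ⊓ inU) K λ e → ∧-trueˡ {K e}) (ℤₚ.drop‿+≤+ K≤)
      where
      K = lookup F₀ ⊻ edgeSet (proj₁ w)
      K≤ : ⁺ count K ℤ.≤ ⁺ size
      K≤ = subst₂ ℤ._≤_ (sym (proj₂ (proj₂ (alongPath w)))) (ℤₚ.+-identityˡ (⁺ size))
             (ℤₚ.+-monoˡ-≤ (⁺ size) (subst (ℤ._≤ ⁺ 0) (sym weight≡) k≤0))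

  attained : ∀ x → InA g U Tt r x →
    ∃ λ J → JoinIn U (λ v → T' v xor single x v) J × count J ≡ size
  attained x (x∈ , zero-distance) = along (proj₁ (zero-distance F₀ F₀-min))
    where
    along : (Σ (Path g U r x) λ w → weight g U F₀ w ≡ ⁺ 0) →
      ∃ λ J → JoinIn U (λ v → T' v xor single x v) J × count J ≡ size
    along (w , weight≡) = lookup F₀ ⊻ edgeSet (proj₁ w) ,
      (proj₁ (alongPath w) , λ v _ → proj₁ (proj₂ (alongPath w)) v) ,
      ℤₚ.+-injective (trans (proj₂ (proj₂ (alongPath w)))
        (trans (cong (ℤ._+ ⁺ size) weight≡) (ℤₚ.+-identityˡ (⁺ size))))

  -- Take a path from `r` to `x` inside `F₀ ⊻ J` and toggle it in both sets. The total size is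
  -- unchanged, `F₀` does not shrink because the distance is 0, and `J` becomes a join for `Tt`.
  joinAt-lower : ∀ x → InA g U Tt r x → ∀ J → Inside J → (∀ v → ∂ J v ≡ T' v xor single x v) → size ≤ count J
  joinAt-lower x (x∈ , zero-distance) J ins bd = byCases (x ≟ r)
    where
    F₀-least : ∀ K → Inside K → (∀ v → ∂ K v ≡ lookup Tt v) → size ≤ count K
    F₀-least K insK bdK = proj₂ (isMinJoinIn⇒ F₀-min) K (insK , λ v _ → bdK v)
    K = lookup F₀ ⊻ J
    K-inside : Inside K
    K-inside e h with lookup F₀ e in f | J e in j
    ... | true  | _    = F₀-inside e f
    ... | false | true = ins e j
    ∂K : ∀ v → ∂ K v ≡ single r v xor single x v
    ∂K v = trans (∂-⊻ (lookup F₀) J v) (trans (cong₂ _xor_ (∂F₀ v) (bd v))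
      (solve 3 (λ t a b → t :+ ((t :+ a) :+ b) := a :+ b) refl (lookup Tt v) (single r v) (single x v)))
    byCases : Dec (x ≡ r) → size ≤ count J
    -- For `x` equal to `r` the difference has no odd vertex to start a path from, but `J` is itself
    -- a join for `Tt`.
    byCases (yes refl) = F₀-least J ins λ v → trans (bd v)
      (solve 2 (λ t a → (t :+ a) :+ a := t) refl (lookup Tt v) (single x v))
    byCases (no x≢r) = exchange
      (extractPath K K-inside r (trans (∂K r) (cong₂ _xor_ (⌊⌋-true {x = r} refl) (⌊⌋-false x≢r))))
      where
      exchange : (∃ λ y → y ≢ r × ∂ K y ≡ true × Σ (Path g U r y) λ w → Within K (proj₁ w)) → size ≤ count J
      exchange (y , y≢r , ∂y , w , win) = along x≡y w win
        where
        x≡y : x ≡ y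
        x≡y = ⌊⌋-sound (trans (sym (trans (∂K y) (cong (_xor single x y) (⌊⌋-false (y≢r ∘ sym))))) ∂y)
        along : ∀ {y} → x ≡ y → (w : Path g U r y) → Within K (proj₁ w) → size ≤ count J
        along refl w win = ℕₚ.+-cancelˡ-≤ size _ _ (begin
          size + size                                ≤⟨ ℕₚ.+-mono-≤ grown least ⟩
          count (lookup F₀ ⊻ S) + count (J ⊻ S)      ≡⟨ count-exchange S (lookup F₀) J (Within⇒⊑ (proj₁ w) win) ⟩
          size + count J ∎)
          where
          open ℕₚ.≤-Reasoning
          S = edgeSet (proj₁ w)
          grown : size ≤ count (lookup F₀ ⊻ S)
          grown = ℤₚ.drop‿+≤+ (subst₂ ℤ._≤_ (ℤₚ.+-identityˡ (⁺ size)) (sym (proj₂ (proj₂ (alongPath w))))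
                    (ℤₚ.+-monoˡ-≤ (⁺ size) (proj₂ (zero-distance F₀ F₀-min) w)))
          JS-inside : Inside (J ⊻ S)
          JS-inside e h with J e in j | S e in s
          ... | true  | _    = ins e j
          ... | false | true = walk-inside (proj₁ w) e s
          ∂JS : ∀ v → ∂ (J ⊻ S) v ≡ lookup Tt v
          ∂JS v = trans (∂-⊻ J S v) (trans (cong₂ _xor_ (bd v) (∂-edgeSet (proj₁ w) v))
            (solve 3 (λ t a b → ((t :+ a) :+ b) :+ (a :+ b) := t) refl (lookup Tt v) (single r v) (single x v)))
          least : size ≤ count (J ⊻ S)
          least = F₀-least (J ⊻ S) JS-inside ∂JS

  -- The colour class is the initial potential. Edges not inside `U` are loops after localisation,
  -- with no cost and no difference.
  colour : ∀ e → inU e ≡ lookup A (P e) xor lookup A (if inU e then Q e else P e)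
  colour e with inU e in eq
  ... | false = sym (xor-same (lookup A (P e)))
  ... | true with proj₂ (proj₂ bip) e (true⇒∈ (∧-trueˡ {lookup U (P e)} eq)) (true⇒∈ (∧-trueʳ {lookup U (P e)} eq))
  ...   | inj₁ (p∈A , q∈B) = sym (cong₂ _xor_ (∈⇒true p∈A) (∉⇒false λ q∈A → proj₁ (proj₂ bip) (Q e) (q∈A , q∈B)))
  ...   | inj₂ (p∈B , q∈A) = sym (cong₂ _xor_ (∉⇒false λ p∈A → proj₁ (proj₂ bip) (P e) (p∈A , p∈B)) (∈⇒true q∈A))

  lower : ∀ (X : V → Bool) → (∀ x → X x ≡ true → InA g U Tt r x) →
    ∀ J → JoinIn U (λ v → T' v xor X v) J → size ≤ count J
  lower X X⊆A J (ins , bd) = ℕₚ.≤-trans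
    (C.cost-lower size inU (lookup A) colour
      (λ e h → reach (P e) (true⇒∈ (∧-trueˡ {lookup U (P e)} h)) ,
               subst (C.AtMost inU size) (cong (if_then Q e else P e) (sym h))
                 (reach (Q e) (true⇒∈ (∧-trueʳ {lookup U (P e)} h))))
      r (proj₁ (reach r r∈U)) (proj₁ (proj₂ (reach r r∈U)))
      X (λ x Xx K join →
          joinAt-lower x (X⊆A x Xx) (K ⊓ inU) (inside-⊓ K) λ v → trans (sym (∂-localised K v)) (join v))
      J boundary)
    (ℕₚ.≤-reflexive (count-cong (J ⊓ inU) J (inside-≡ ins)))
    where
    boundary : ∀ v → L.∂ J v ≡ T' v xor X v
    boundary v with v ∈? U
    ... | yes v∈ = trans (∂-inside ins v) (bd v v∈)
    ... | no v∉  = trans (trans (∂-inside ins v) (∂-outside ins v v∉))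
      (sym (cong₂ _xor_ (cong₂ _xor_ (outside-Tt v v∉) (⌊⌋-false λ { refl → v∉ r∈U }))
                        (≢true⇒≡false λ Xv → v∉ (proj₁ (X⊆A v Xv)))))

-- Contracting the teeth of a synthesis.

module Synthesis (G : Graph) (T A B : Subset (nV G)) (Ĝ : Graph) (T̂ : Subset (nV Ĝ))
  (φ : Fin (nV Ĝ) → Fin (nV G)) (ψ : Fin (nE G) → Fin (nE Ĝ))
  (Tt Av Bv : Fin (nV G) → Subset (nV Ĝ)) (r : Fin (nV G) → Fin (nV Ĝ))
  (syn : IsSynthesis G T A B Ĝ T̂ φ ψ Tt Av Bv r) where

  open IsSynthesis syn

  private
    V = Fin (nV G)
    E = Fin (nE G)
    V̂ = Fin (nV Ĝ)
    Ê = Fin (nE Ĝ)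
    module GB = Boundary G

  open Boundary Ĝ

  loopless : ∀ e → proj₁ (ends G e) ≢ proj₂ (ends G e)
  loopless = bipartition⇒loopless G (proj₁ comb)

  loopless^ : ∀ e → proj₁ (ends Ĝ e) ≢ proj₂ (ends Ĝ e)
  loopless^ = bipartition⇒loopless Ĝ (proj₂ (proj₂ hatBip))

  module GL = Loopless G loopless
  open Loopless Ĝ loopless^

  lookup-fibre : ∀ v x → lookup (fibre φ v) x ≡ single (φ x) v
  lookup-fibre v x = lookup∘tabulate (λ x → single (φ x) v) x

  ∈fibre : ∀ {x v} → φ x ≡ v → x ∈ fibre φ v
  ∈fibre {x} {v} h = true⇒∈ (trans (lookup-fibre v x) (⌊⌋-true h))

  fibre∋ : ∀ {x v} → x ∈ fibre φ v → φ x ≡ v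
  fibre∋ {x} {v} h = ⌊⌋-sound (trans (sym (lookup-fibre v x)) (∈⇒true h))

  A∩B : ∀ {v} → v ∈ A → v ∈ B → ∀ {X : Set} → X
  A∩B {v} a b = ⊥-elim (proj₁ (proj₂ (proj₁ comb)) v (a , b))

  A∪B : ∀ v → v ∈ A ⊎ v ∈ B
  A∪B v = to (proj₁ (proj₁ comb) v) ∈⊤

  cross : Ê → Bool
  cross ê = not (single (φ (P ê)) (φ (Q ê)))

  inner : V → Ê → Bool
  inner v ê = single (φ (P ê)) v ∧ single (φ (Q ê)) v

  cross⇒≢ : ∀ {ê} → cross ê ≡ true → φ (P ê) ≢ φ (Q ê)
  cross⇒≢ h eq = true≢false (trans (sym h) (cong not (⌊⌋-true eq)))

  ≢⇒cross : ∀ {ê} → φ (P ê) ≢ φ (Q ê) → cross ê ≡ true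
  ≢⇒cross h = cong not (⌊⌋-false h)

  cross-ψ : ∀ e → cross (ψ e) ≡ true
  cross-ψ e = ≢⇒cross (to (ψ-image (ψ e)) (e , refl))

  cross⇒ψ : ∀ ê → cross ê ≡ true → ∃ λ e → ψ e ≡ ê
  cross⇒ψ ê h = from (ψ-image ê) (cross⇒≢ h)

  inner-ends : ∀ {v ê} → inner v ê ≡ true → φ (P ê) ≡ v × φ (Q ê) ≡ v
  inner-ends {v} {ê} h = ⌊⌋-sound (∧-trueˡ {single (φ (P ê)) v} h) , ⌊⌋-sound (∧-trueʳ {single (φ (P ê)) v} h)

  ends⇒inner : ∀ {v ê} → φ (P ê) ≡ v → φ (Q ê) ≡ v → inner v ê ≡ true
  ends⇒inner p q = ∧-intro (⌊⌋-true p) (⌊⌋-true q)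

  -- The fibre of a spine vertex is a single vertex, so an edge inside it would be a loop.
  inner⇒B : ∀ {v ê} → inner v ê ≡ true → v ∈ B
  inner⇒B {v} {ê} h with A∪B v
  ... | inj₂ v∈B = v∈B
  ... | inj₁ v∈A = let p , q = inner-ends h ; x , _ , unique = contrA v v∈A in
        contradiction (trans (unique (P ê) p) (sym (unique (Q ê) q))) (loopless^ ê)

  inner-ψ : ∀ v e → inner v (ψ e) ≡ false
  inner-ψ v e = ≢true⇒≡false λ h → let p , q = inner-ends h in cross⇒≢ (cross-ψ e) (trans p (sym q))

  inner-unique : ∀ {v w ê} → inner v ê ≡ true → inner w ê ≡ true → w ≡ v
  inner-unique h k = trans (sym (proj₁ (inner-ends k))) (proj₁ (inner-ends h))

  inside⇒inner : ∀ {v J} → WalkSets.Inside Ĝ (fibre φ v) J → J ⊑ inner v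
  inside⇒inner ins e h = ends⇒inner (fibre∋ (proj₁ (ins e h))) (fibre∋ (proj₂ (ins e h)))

  inside-inner : ∀ {v} J → WalkSets.Inside Ĝ (fibre φ v) (J ⊓ inner v)
  inside-inner J e h = let p , q = inner-ends (∧-trueʳ {J e} h) in ∈fibre p , ∈fibre q

  count-cross : ∀ F̂ → count (F̂ ⊓ cross) ≡ count (F̂ ∘ ψ)
  count-cross F̂ = trans
    (∑.sum-reindex ψ ψ-inj (⟦_⟧ ∘ (F̂ ⊓ cross)) λ ê off → cong ⟦_⟧ (≢true⇒≡false λ h →
      let e , eq = cross⇒ψ ê (∧-trueʳ {F̂ ê} h) in off e eq))
    (count-cong ((F̂ ⊓ cross) ∘ ψ) (F̂ ∘ ψ) λ e → trans (cong (F̂ (ψ e) ∧_) (cross-ψ e)) (∧-identityʳ (F̂ (ψ e))))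

  count-split : ∀ F̂ → count F̂ ≡ count (F̂ ∘ ψ) + ∑.sum (λ v → count (F̂ ⊓ inner v))
  count-split F̂ = begin
    count F̂
      ≡⟨ ∑.sum-cong-≗ pointwise ⟩
    ∑.sum (λ ê → ⟦ F̂ ê ∧ cross ê ⟧ + ∑.sum (λ v → ⟦ F̂ ê ∧ inner v ê ⟧))
      ≡⟨ ∑.∑-distrib-+ (λ ê → ⟦ F̂ ê ∧ cross ê ⟧) (λ ê → ∑.sum (λ v → ⟦ F̂ ê ∧ inner v ê ⟧)) ⟩
    count (F̂ ⊓ cross) + ∑.sum (λ ê → ∑.sum (λ v → ⟦ F̂ ê ∧ inner v ê ⟧))
      ≡⟨ cong₂ _+_ (count-cross F̂) (∑.∑-comm (λ ê v → ⟦ F̂ ê ∧ inner v ê ⟧)) ⟩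
    count (F̂ ∘ ψ) + ∑.sum (λ v → count (F̂ ⊓ inner v)) ∎
    where
    open ≡-Reasoning
    pointwise : ∀ ê → ⟦ F̂ ê ⟧ ≡ ⟦ F̂ ê ∧ cross ê ⟧ + ∑.sum (λ v → ⟦ F̂ ê ∧ inner v ê ⟧)
    pointwise ê = byCases (φ (P ê) ≟ φ (Q ê))
      where
      byCases : Dec (φ (P ê) ≡ φ (Q ê)) → ⟦ F̂ ê ⟧ ≡ ⟦ F̂ ê ∧ cross ê ⟧ + ∑.sum (λ v → ⟦ F̂ ê ∧ inner v ê ⟧)
      byCases (yes eq) = sym (cong₂ _+_
        (cong ⟦_⟧ (trans (cong (F̂ ê ∧_) (cong not (⌊⌋-true eq))) (∧-zeroʳ (F̂ ê))))
        (trans (∑.sum-single (λ v → ⟦ F̂ ê ∧ inner v ê ⟧) (φ (P ê)) λ v v≢ → cong ⟦_⟧ (≢true⇒≡false λ h →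
                  v≢ (sym (proj₁ (inner-ends (∧-trueʳ {F̂ ê} h))))))
               (cong ⟦_⟧ (trans (cong (F̂ ê ∧_) (ends⇒inner refl (sym eq))) (∧-identityʳ (F̂ ê))))))
      byCases (no ne) = sym (trans (cong₂ _+_
        (cong ⟦_⟧ (trans (cong (F̂ ê ∧_) (≢⇒cross ne)) (∧-identityʳ (F̂ ê))))
        (∑.sum-zero (λ v → ⟦ F̂ ê ∧ inner v ê ⟧) λ v → cong ⟦_⟧ (≢true⇒≡false λ h →
          let p , q = inner-ends (∧-trueʳ {F̂ ê} h) in ne (trans p (sym q)))))
        (ℕₚ.+-identityʳ _))

  ∂-split : ∀ F̂ {v} x → φ x ≡ v → ∂ F̂ x ≡ ∂ (F̂ ⊓ inner v) x xor ∂ (F̂ ⊓ cross) x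
  ∂-split F̂ {v} x eq = trans (⊕.sum-cong-≗ pointwise)
    (⊕.∑-distrib-+ (λ ê → (F̂ ê ∧ inner v ê) ∧ inc ê x) (λ ê → (F̂ ê ∧ cross ê) ∧ inc ê x))
    where
    combine : ∀ f i c k → (k ≡ true → i xor c ≡ true) → f ∧ k ≡ ((f ∧ i) ∧ k) xor ((f ∧ c) ∧ k)
    combine false i     c     k     _ = refl
    combine true  i     c     false _ = sym (cong₂ _xor_ (∧-zeroʳ i) (∧-zeroʳ c))
    combine true  i     c     true  h = sym (trans (cong₂ _xor_ (∧-identityʳ i) (∧-identityʳ c)) (h refl))
    exclusive : ∀ ê → IsEnd Ĝ x ê → Dec (φ (P ê) ≡ φ (Q ê)) → inner v ê xor cross ê ≡ true
    exclusive ê (inj₁ refl) (yes same) = cong₂ _xor_ (ends⇒inner eq (trans (sym same) eq)) (cong not (⌊⌋-true same))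
    exclusive ê (inj₂ refl) (yes same) = cong₂ _xor_ (ends⇒inner (trans same eq) eq) (cong not (⌊⌋-true same))
    exclusive ê _           (no ne)    = cong₂ _xor_
      (≢true⇒≡false λ h → let p , q = inner-ends h in ne (trans p (sym q))) (≢⇒cross ne)
    pointwise : ∀ ê → F̂ ê ∧ inc ê x ≡ ((F̂ ê ∧ inner v ê) ∧ inc ê x) xor ((F̂ ê ∧ cross ê) ∧ inc ê x)
    pointwise ê = combine (F̂ ê) (inner v ê) (cross ê) (inc ê x) λ h →
      exclusive ê (inc-end ê x h) (φ (P ê) ≟ φ (Q ê))

  -- Take the indicator of the fibre of `u` as potential: edges inside a fibre contribute nothing,
  -- and the others are the images of edges of `G`.
  ∂-contract : ∀ F̂ u → GB.∂ (F̂ ∘ ψ) u ≡ ⊕.sum (λ x → single (φ x) u ∧ ∂ F̂ x)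
  ∂-contract F̂ u = sym (begin
    ⊕.sum (λ x → single (φ x) u ∧ ∂ F̂ x)
      ≡⟨ ∂-potential (λ x → single (φ x) u) F̂ ⟩
    ⊕.sum (λ ê → F̂ ê ∧ (single (φ (P ê)) u xor single (φ (Q ê)) u))
      ≡⟨ ⊕.sum-reindex ψ ψ-inj (λ ê → F̂ ê ∧ (single (φ (P ê)) u xor single (φ (Q ê)) u)) off ⟩
    ⊕.sum (λ e → F̂ (ψ e) ∧ (single (φ (P (ψ e))) u xor single (φ (Q (ψ e))) u))
      ≡⟨ ⊕.sum-cong-≗ (λ e → cong (F̂ (ψ e) ∧_) (sym (GB.Joins-inc {e} (ψ-ends e) u))) ⟩
    GB.∂ (F̂ ∘ ψ) u ∎)
    where
    open ≡-Reasoning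
    off : ∀ ê → (∀ e → ψ e ≢ ê) → F̂ ê ∧ (single (φ (P ê)) u xor single (φ (Q ê)) u) ≡ false
    off ê none = byCases (φ (P ê) ≟ φ (Q ê))
      where
      byCases : Dec (φ (P ê) ≡ φ (Q ê)) → F̂ ê ∧ (single (φ (P ê)) u xor single (φ (Q ê)) u) ≡ false
      byCases (yes eq) = trans
        (cong (F̂ ê ∧_) (trans (cong (λ w → single w u xor single (φ (Q ê)) u) eq) (xor-same (single (φ (Q ê)) u))))
        (∧-zeroʳ (F̂ ê))
      byCases (no ne)  = let e , eq = from (ψ-image ê) ne in contradiction eq (none e)

  T-contract : ∀ u → lookup T u ≡ ⊕.sum (λ x → single (φ x) u ∧ lookup T̂ x)
  T-contract u = trans
    (bool-ext (λ h → Odd⇒odd? k (to (contrTerm u) (true⇒∈ h))) (λ h → ∈⇒true (from (contrTerm u) (odd?⇒Odd k h))))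
    (trans (cong odd? (∣∣≡count (T̂ ∩ fibre φ u))) (trans (odd?-count (lookup (T̂ ∩ fibre φ u)))
      (⊕.sum-cong-≗ λ x → trans (lookup-∩ T̂ (fibre φ u) x)
        (trans (∧-comm (lookup T̂ x) _) (cong (_∧ lookup T̂ x) (lookup-fibre u x))))))
    where
    k = ∣ T̂ ∩ fibre φ u ∣

  Join : (E → Bool) → Set
  Join = GL.JoinIn ⊤ (lookup T)

  Join^ : (Ê → Bool) → Set
  Join^ = JoinIn ⊤ (lookup T̂)

  contract-join : ∀ F̂ → Join^ F̂ → Join (F̂ ∘ ψ)
  contract-join F̂ (_ , bd) = (λ _ _ → ∈⊤ , ∈⊤) , λ u _ → trans (∂-contract F̂ u)
    (trans (⊕.sum-cong-≗ λ x → cong (single (φ x) u ∧_) (bd x ∈⊤)) (sym (T-contract u)))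

  T' : V → V̂ → Bool
  T' v x = lookup (Tt v) x xor single (r v) x

  root∈ : ∀ v → v ∈ B → r v ∈ fibre φ v
  root∈ v v∈B = from (proj₁ (toothBip v v∈B) (r v)) (inj₁ (rootIn v v∈B))

  T'≡ : ∀ v → v ∈ B → ∀ x → lookup T̂ x ∧ single (φ x) v ≡ T' v x
  T'≡ v v∈B x = begin
    lookup T̂ x ∧ single (φ x) v                  ≡⟨ cong (lookup T̂ x ∧_) (lookup-fibre v x) ⟨
    lookup T̂ x ∧ lookup (fibre φ v) x            ≡⟨ lookup-∩ T̂ (fibre φ v) x ⟨
    lookup (T̂ ∩ fibre φ v) x                     ≡⟨ cong (λ S → lookup S x) (cond1 v v∈B) ⟩
    lookup (Tt v Δ ⁅ r v ⁆) x                    ≡⟨ lookup-Δ (Tt v) ⁅ r v ⁆ x ⟩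
    lookup (Tt v) x xor lookup ⁅ r v ⁆ x         ≡⟨ cong (lookup (Tt v) x xor_) (lookup-⁅⁆ (r v) x) ⟩
    T' v x ∎
    where open ≡-Reasoning

  T̂≡T' : ∀ v → v ∈ B → ∀ x → φ x ≡ v → lookup T̂ x ≡ T' v x
  T̂≡T' v v∈B x eq = trans (sym (∧-identityʳ (lookup T̂ x)))
    (trans (cong (lookup T̂ x ∧_) (sym (⌊⌋-true eq))) (T'≡ v v∈B x))

  tooth-terminals : ∀ v → v ∈ B → ∀ x → x ∈ Tt v → x ∈ fibre φ v
  tooth-terminals v v∈B x x∈ = byCases (φ x ≟ v)
    where
    byCases : Dec (φ x ≡ v) → x ∈ fibre φ v
    byCases (yes eq) = ∈fibre eq
    byCases (no ne)  = ⊥-elim (true≢false (begin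
      true                           ≡⟨ cong₂ _xor_ (∈⇒true x∈) (⌊⌋-false λ { refl → ne (fibre∋ (root∈ v v∈B)) }) ⟨
      T' v x                         ≡⟨ T'≡ v v∈B x ⟨
      lookup T̂ x ∧ single (φ x) v    ≡⟨ cong (lookup T̂ x ∧_) (⌊⌋-false ne) ⟩
      lookup T̂ x ∧ false             ≡⟨ ∧-zeroʳ (lookup T̂ x) ⟩
      false                          ∎))
      where open ≡-Reasoning

  Contact : V → V̂ → Set
  Contact v x = InA Ĝ (fibre φ v) (Tt v) (r v) x

  record ToothSize (v : V) (n : ℕ) : Set where
    field
      lower : ∀ (X : V̂ → Bool) → (∀ x → X x ≡ true → Contact v x) →
        ∀ J → JoinIn (fibre φ v) (λ x → T' v x xor X x) J → n ≤ count J
      attained : ∀ x → Contact v x →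
        ∃ λ J → JoinIn (fibre φ v) (λ y → T' v y xor single x y) J × count J ≡ n

  -- The value 0 off `B` lets the sum of the n_v run over all vertices of `G`.
  toothSize : ∀ v → ∃ λ n → (v ∈ B → ToothSize v n) × (v ∉ B → n ≡ 0)
  toothSize v with v ∈? B
  ... | no v∉B  = 0 , (λ v∈B → contradiction v∈B v∉B) , λ _ → refl
  ... | yes v∈B = Th.size , (λ _ → record { lower = Th.lower ; attained = Th.attained }) , λ v∉B → contradiction v∈B v∉B
    where
    module Th = Tooth Ĝ loopless^ (fibre φ v) (Av v) (Bv v) (toothBip v v∈B) (Tt v) (r v)
                  (root∈ v v∈B) (tooth-terminals v v∈B) (toothPrimal v v∈B)

  size : V → ℕ
  size v = proj₁ (toothSize v)

  module Size v (v∈B : v ∈ B) = ToothSize (proj₁ (proj₂ (toothSize v)) v∈B)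

  -- Condition (3) names two ends, one over `A` and one in A(r_v); an end lying over the tooth
  -- vertex `v` must be the second.
  contact : ∀ {v} → v ∈ B → ∀ {ê x} → cross ê ≡ true → φ x ≡ v → IsEnd Ĝ x ê → Contact v x
  contact {v} v∈B {ê} {x} cr eq end =
    let y , z , joins , y∈A , z∈ = to (cond3 v v∈B ê) (sides end) in far-end joins y∈A z∈ end
    where
    sides : IsEnd Ĝ x ê → ((P ê ∈ fibre φ v) × (Q ê ∉ fibre φ v)) ⊎ ((P ê ∉ fibre φ v) × (Q ê ∈ fibre φ v))
    sides (inj₁ refl) = inj₁ (∈fibre eq , λ q → cross⇒≢ cr (trans eq (sym (fibre∋ q))))
    sides (inj₂ refl) = inj₂ ((λ p → cross⇒≢ cr (trans (fibre∋ p) (sym eq))) , ∈fibre eq)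
    far-end : ∀ {y z} → Joins Ĝ ê y z → φ y ∈ A → Contact v z → IsEnd Ĝ x ê → Contact v x
    far-end (inj₁ refl) y∈A z∈ (inj₁ refl) = A∩B y∈A (subst (_∈ B) (sym eq) v∈B)
    far-end (inj₂ refl) y∈A z∈ (inj₁ refl) = z∈
    far-end (inj₁ refl) y∈A z∈ (inj₂ refl) = z∈
    far-end (inj₂ refl) y∈A z∈ (inj₂ refl) = A∩B y∈A (subst (_∈ B) (sym eq) v∈B)

  -- The edges entering the tooth shift its terminals: `X` consists of the vertices where an odd
  -- number of them end.
  tooth-join : ∀ F̂ → Join^ F̂ → ∀ v → v ∈ B →
    JoinIn (fibre φ v) (λ x → T' v x xor (single (φ x) v ∧ ∂ (F̂ ⊓ cross) x)) (F̂ ⊓ inner v)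
  tooth-join F̂ (_ , bd) v v∈B = inside-inner F̂ , λ x x∈ → let eq = fibre∋ x∈ in begin
    ∂ (F̂ ⊓ inner v) x
      ≡⟨ solve 2 (λ i k → i := (i :+ k) :+ k) refl (∂ (F̂ ⊓ inner v) x) (∂ (F̂ ⊓ cross) x) ⟩
    (∂ (F̂ ⊓ inner v) x xor ∂ (F̂ ⊓ cross) x) xor ∂ (F̂ ⊓ cross) x
      ≡⟨ cong (_xor ∂ (F̂ ⊓ cross) x) (trans (sym (∂-split F̂ x eq)) (trans (bd x ∈⊤) (T̂≡T' v v∈B x eq))) ⟩
    T' v x xor ∂ (F̂ ⊓ cross) x
      ≡⟨ cong (λ s → T' v x xor (s ∧ ∂ (F̂ ⊓ cross) x)) (⌊⌋-true eq) ⟨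
    T' v x xor (single (φ x) v ∧ ∂ (F̂ ⊓ cross) x) ∎
    where open ≡-Reasoning

  tooth-lower : ∀ F̂ → Join^ F̂ → ∀ v → size v ≤ count (F̂ ⊓ inner v)
  tooth-lower F̂ join v = byCases (v ∈? B)
    where
    X : V̂ → Bool
    X x = single (φ x) v ∧ ∂ (F̂ ⊓ cross) x
    X⊆Contact : v ∈ B → ∀ x → X x ≡ true → Contact v x
    X⊆Contact v∈B x h =
      let ê , h' = ⊕-true (λ ê → (F̂ ⊓ cross) ê ∧ inc ê x) (∧-trueʳ {single (φ x) v} h) in
      contact v∈B {ê} (∧-trueʳ {F̂ ê} (∧-trueˡ {(F̂ ⊓ cross) ê} h')) (⌊⌋-sound (∧-trueˡ {single (φ x) v} h))
        (inc-end ê x (∧-trueʳ {(F̂ ⊓ cross) ê} h'))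
    byCases : Dec (v ∈ B) → size v ≤ count (F̂ ⊓ inner v)
    byCases (yes v∈B) = Size.lower v v∈B X (X⊆Contact v∈B) (F̂ ⊓ inner v) (tooth-join F̂ join v v∈B)
    byCases (no v∉B)  = ℕₚ.≤-trans (ℕₚ.≤-reflexive (proj₂ (proj₂ (toothSize v)) v∉B)) z≤n

  count-lower : ∀ F̂ → Join^ F̂ → count (F̂ ∘ ψ) + ∑.sum size ≤ count F̂
  count-lower F̂ join = ℕₚ.≤-trans
    (ℕₚ.+-monoʳ-≤ (count (F̂ ∘ ψ)) (sum-mono size (λ v → count (F̂ ⊓ inner v)) (tooth-lower F̂ join)))
    (ℕₚ.≤-reflexive (sym (count-split F̂)))

  MinJoin : (E → Bool) → Set
  MinJoin = GL.MinJoinIn ⊤ (lookup T)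

  -- `edge` is the unique edge of `F` at `v`, and `vertex` is r'_v.
  record Attachment (F : E → Bool) (v : V) : Set where
    field
      edge    : E
      edge∈   : F edge ≡ true
      atTooth : IsEnd G v edge
      unique  : ∀ e → F e ≡ true → IsEnd G v e → e ≡ edge
      vertex  : V̂
      vertex∈ : φ vertex ≡ v
      isEndOf : IsEnd Ĝ vertex (ψ edge)

  attachment : ∀ F → MinJoin F → ∀ v → v ∈ B → Attachment F v
  attachment F min v v∈B =
    let e , e∧ , unique = count-one (λ e → F e ∧ GB.inc e v) degree
        end = GB.inc-end e v (∧-trueʳ {F e} e∧)
        x , x∈ , xEnd = liftEnd e end
    in record
      { edge = e ; edge∈ = ∧-trueˡ {F e} e∧ ; atTooth = end
      ; unique = λ e' f end' → unique e' (∧-intro f (GL.IsEnd⇒inc v e' end'))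
      ; vertex = x ; vertex∈ = x∈ ; isEndOf = xEnd }
    where
    minF : IsMinJoin G T (tabulate F)
    minF = GL.isMinJoinIn⇐ (GL.MinJoinIn-cong (sym ∘ lookup∘tabulate F) min)
    degree : count (λ e → F e ∧ GB.inc e v) ≡ 1
    degree = trans (count-cong (λ e → F e ∧ GB.inc e v) (λ e → lookup (tabulate F) e ∧ GB.inc e v)
                      λ e → cong (_∧ GB.inc e v) (sym (lookup∘tabulate F e)))
      (trans (sym (GL.deg≡count (tabulate F) v)) (proj₂ comb (tabulate F) minF v v∈B))
    liftEnd : ∀ e → IsEnd G v e → ∃ λ x → φ x ≡ v × IsEnd Ĝ x (ψ e)
    liftEnd e end with ψ-ends e | end
    ... | inj₁ eq | inj₁ refl = P (ψ e) , sym (cong proj₁ eq) , inj₁ refl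
    ... | inj₁ eq | inj₂ refl = Q (ψ e) , sym (cong proj₂ eq) , inj₂ refl
    ... | inj₂ eq | inj₁ refl = Q (ψ e) , sym (cong proj₁ eq) , inj₂ refl
    ... | inj₂ eq | inj₂ refl = P (ψ e) , sym (cong proj₂ eq) , inj₁ refl

  ψ-end : ∀ {e x v} → φ x ≡ v → IsEnd Ĝ x (ψ e) → IsEnd G v e
  ψ-end {e} refl end with ψ-ends e | end
  ... | inj₁ eq | inj₁ refl = inj₁ (cong proj₁ eq)
  ... | inj₁ eq | inj₂ refl = inj₂ (cong proj₂ eq)
  ... | inj₂ eq | inj₁ refl = inj₂ (cong proj₂ eq)
  ... | inj₂ eq | inj₂ refl = inj₁ (cong proj₁ eq)

  inc-attached : ∀ {ê x y} → cross ê ≡ true → IsEnd Ĝ y ê → φ x ≡ φ y → inc ê x ≡ single y x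
  inc-attached {ê} {x} cr (inj₁ refl) eq = trans
    (cong (single (P ê) x xor_) (⌊⌋-false {x = Q ê} {x} λ { refl → cross⇒≢ cr (sym eq) })) (xor-identityʳ _)
  inc-attached {ê} {x} cr (inj₂ refl) eq =
    cong (_xor single (Q ê) x) (⌊⌋-false {x = P ê} {x} λ { refl → cross⇒≢ cr eq })

  same-end : ∀ {e x y} → φ x ≡ φ y → IsEnd Ĝ x (ψ e) → IsEnd Ĝ y (ψ e) → x ≡ y
  same-end {e} eq (inj₁ refl) (inj₁ refl) = refl
  same-end {e} eq (inj₁ refl) (inj₂ refl) = contradiction eq (cross⇒≢ (cross-ψ e))
  same-end {e} eq (inj₂ refl) (inj₁ refl) = contradiction (sym eq) (cross⇒≢ (cross-ψ e))
  same-end {e} eq (inj₂ refl) (inj₂ refl) = refl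

  ∂-cross : ∀ F̂ F → (∀ e → F̂ (ψ e) ≡ F e) → ∀ {v} (a : Attachment F v) → ∀ x → φ x ≡ v →
    ∂ (F̂ ⊓ cross) x ≡ single (Attachment.vertex a) x
  ∂-cross F̂ F restrict {v} a x eq = begin
    ∂ (F̂ ⊓ cross) x
      ≡⟨ ⊕.sum-reindex ψ ψ-inj (λ ê → (F̂ ⊓ cross) ê ∧ inc ê x) off ⟩
    ⊕.sum (λ e → (F̂ ⊓ cross) (ψ e) ∧ inc (ψ e) x)
      ≡⟨ ⊕.sum-cong-≗ (λ e → cong (_∧ inc (ψ e) x) (trans (cong₂ _∧_ (restrict e) (cross-ψ e)) (∧-identityʳ (F e)))) ⟩
    ⊕.sum (λ e → F e ∧ inc (ψ e) x)
      ≡⟨ ⊕.sum-single (λ e → F e ∧ inc (ψ e) x) edge (λ e e≢ → ≢true⇒≡false λ h →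
           e≢ (unique e (∧-trueˡ {F e} h) (ψ-end eq (inc-end (ψ e) x (∧-trueʳ {F e} h))))) ⟩
    F edge ∧ inc (ψ edge) x
      ≡⟨ cong (_∧ inc (ψ edge) x) edge∈ ⟩
    inc (ψ edge) x
      ≡⟨ inc-attached (cross-ψ edge) isEndOf (trans eq (sym vertex∈)) ⟩
    single vertex x ∎
    where
    open ≡-Reasoning
    open Attachment a
    off : ∀ ê → (∀ e → ψ e ≢ ê) → (F̂ ⊓ cross) ê ∧ inc ê x ≡ false
    off ê none = ≢true⇒≡false λ h →
      let e , eq' = cross⇒ψ ê (∧-trueʳ {F̂ ê} (∧-trueˡ {(F̂ ⊓ cross) ê} h)) in none e eq'

  -- Gluing tooth joins to a minimum join of the skeleton.

  Fits : (v : V) → V̂ → (Ê → Bool) → Set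
  Fits v x J = JoinIn (fibre φ v) (λ y → T' v y xor single x y) J × count J ≡ size v

  -- `F̂` is described by its restrictions, so that one argument serves both the set built in
  -- `extend` and the set given in `assembled⇒min`.
  module Extension (F : E → Bool) (F-min : MinJoin F) (Fv : V → Ê → Bool)
    (fits : ∀ v (v∈B : v ∈ B) → Fits v (Attachment.vertex {F} {v} (attachment F F-min v v∈B)) (Fv v))
    (F̂ : Ê → Bool) (restrict : ∀ e → F̂ (ψ e) ≡ F e)
    (onTeeth : ∀ v → v ∈ B → ∀ ê → inner v ê ≡ true → F̂ ê ≡ Fv v ê) where

    inner≡ : ∀ v → v ∈ B → ∀ ê → (F̂ ⊓ inner v) ê ≡ Fv v ê
    inner≡ v v∈B ê = bool-ext
      (λ h → trans (sym (onTeeth v v∈B ê (∧-trueʳ {F̂ ê} h))) (∧-trueˡ {F̂ ê} h))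
      (λ h → let i = inside⇒inner (proj₁ (proj₁ (fits v v∈B))) ê h in
             ∧-intro (trans (onTeeth v v∈B ê i) h) i)

    extension-count : count F̂ ≡ count F + ∑.sum size
    extension-count = trans (count-split F̂)
      (cong₂ _+_ (count-cong (F̂ ∘ ψ) F restrict) (∑.sum-cong-≗ λ v → byCases v (v ∈? B)))
      where
      byCases : ∀ v → Dec (v ∈ B) → count (F̂ ⊓ inner v) ≡ size v
      byCases v (yes v∈B) = trans (count-cong (F̂ ⊓ inner v) (Fv v) (inner≡ v v∈B)) (proj₂ (fits v v∈B))
      byCases v (no v∉B)  = trans
        (∑.sum-zero (⟦_⟧ ∘ (F̂ ⊓ inner v)) λ ê → cong ⟦_⟧ (≢true⇒≡false λ h → v∉B (inner⇒B (∧-trueʳ {F̂ ê} h))))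
        (sym (proj₂ (proj₂ (toothSize v)) v∉B))

    extension-join : Join^ F̂
    extension-join = (λ _ _ → ∈⊤ , ∈⊤) , λ x _ → byCases x (A∪B (φ x))
      where
      open ≡-Reasoning
      atA : ∀ x → φ x ∈ A → (S : V̂ → Bool) → ⊕.sum (λ y → single (φ y) (φ x) ∧ S y) ≡ S x
      atA x x∈A S = let z , _ , unique = contrA (φ x) x∈A in trans
        (⊕.sum-single (λ y → single (φ y) (φ x) ∧ S y) x λ y y≢x → ≢true⇒≡false λ h →
          y≢x (trans (unique y (⌊⌋-sound (∧-trueˡ {single (φ y) (φ x)} h))) (sym (unique x refl))))
        (cong (_∧ S x) (⌊⌋-true {x = φ x} refl))
      byCases : ∀ x → φ x ∈ A ⊎ φ x ∈ B → ∂ F̂ x ≡ lookup T̂ x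
      -- The fibre of a spine vertex is `x` alone, so the parity at `x` can be read off in `G`.
      byCases x (inj₁ x∈A) = begin
        ∂ F̂ x                                            ≡⟨ atA x x∈A (∂ F̂) ⟨
        ⊕.sum (λ y → single (φ y) (φ x) ∧ ∂ F̂ y)         ≡⟨ ∂-contract F̂ (φ x) ⟨
        GB.∂ (F̂ ∘ ψ) (φ x)                               ≡⟨ GB.∂-cong (F̂ ∘ ψ) F restrict (φ x) ⟩
        GB.∂ F (φ x)                                     ≡⟨ proj₂ (proj₁ F-min) (φ x) ∈⊤ ⟩
        lookup T (φ x)                                   ≡⟨ T-contract (φ x) ⟩
        ⊕.sum (λ y → single (φ y) (φ x) ∧ lookup T̂ y)    ≡⟨ atA x x∈A (lookup T̂) ⟩
        lookup T̂ x ∎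
      -- The one edge of `F` attached to the tooth ends at `z` and cancels the extra terminal `z` of
      -- `Fv v`.
      byCases x (inj₂ x∈B) = begin
        ∂ F̂ x
          ≡⟨ ∂-split F̂ x refl ⟩
        ∂ (F̂ ⊓ inner v) x xor ∂ (F̂ ⊓ cross) x
          ≡⟨ cong₂ _xor_ (∂-cong (F̂ ⊓ inner v) (Fv v) (inner≡ v x∈B) x) (∂-cross F̂ F restrict a x refl) ⟩
        ∂ (Fv v) x xor single z x
          ≡⟨ cong (_xor single z x) (proj₂ (proj₁ (fits v x∈B)) x (∈fibre refl)) ⟩
        (T' v x xor single z x) xor single z x
          ≡⟨ solve 2 (λ t z → (t :+ z) :+ z := t) refl (T' v x) (single z x) ⟩
        T' v x
          ≡⟨ T̂≡T' v x∈B x refl ⟨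
        lookup T̂ x ∎
        where
        v = φ x
        a = attachment F F-min v x∈B
        z = Attachment.vertex a

    extension-min : MinJoinIn ⊤ (lookup T̂) F̂
    extension-min = extension-join , λ K joinK → begin
      count F̂                           ≡⟨ extension-count ⟩
      count F + ∑.sum size              ≤⟨ ℕₚ.+-monoˡ-≤ (∑.sum size) (proj₂ F-min (K ∘ ψ) (contract-join K joinK)) ⟩
      count (K ∘ ψ) + ∑.sum size        ≤⟨ count-lower K joinK ⟩
      count K ∎
      where open ℕₚ.≤-Reasoning

  extend : ∀ F → MinJoin F → ∃ λ F̂ → MinJoinIn ⊤ (lookup T̂) F̂ × (∀ e → F̂ (ψ e) ≡ F e) × count F̂ ≡ count F + ∑.sum size
  extend F F-min = F̂ , extension-min , restrict , extension-count
    where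
    module At v v∈B = Attachment (attachment F F-min v v∈B)
    -- The attachment formally depends on the proof of `v ∈ B`; uniqueness of its edge makes the
    -- vertex independent of it.
    sameVertex : ∀ v (v∈B v∈B' : v ∈ B) → At.vertex v v∈B ≡ At.vertex v v∈B'
    sameVertex v v∈B v∈B' = same-end (trans (At.vertex∈ v v∈B) (sym (At.vertex∈ v v∈B'))) (At.isEndOf v v∈B)
      (subst (λ e → IsEnd Ĝ (At.vertex v v∈B') (ψ e))
        (At.unique v v∈B (At.edge v v∈B') (At.edge∈ v v∈B') (At.atTooth v v∈B')) (At.isEndOf v v∈B'))
    found : ∀ v v∈B → ∃ (Fits v (At.vertex v v∈B))
    found v v∈B = Size.attained v v∈B (At.vertex v v∈B)
      (contact v∈B (cross-ψ (At.edge v v∈B)) (At.vertex∈ v v∈B) (At.isEndOf v v∈B))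
    tooth : ∀ v → Dec (v ∈ B) → ∃ λ J → (v∈B : v ∈ B) → Fits v (At.vertex v v∈B) J
    tooth v (no v∉B)  = (λ _ → false) , λ v∈B → contradiction v∈B v∉B
    tooth v (yes v∈B) = proj₁ (found v v∈B) , λ v∈B' →
      subst (λ x → Fits v x (proj₁ (found v v∈B))) (sameVertex v v∈B v∈B') (proj₂ (found v v∈B))
    Fv : V → Ê → Bool
    Fv v = proj₁ (tooth v (v ∈? B))
    lifted? : ∀ ê → Dec (∃ λ e → ψ e ≡ ê × F e ≡ true)
    lifted? ê = any? λ e → (ψ e ≟ ê) ×-dec (F e Data.Bool.≟ true)
    -- An edge inside a fibre is looked up in the tooth of its first end.
    F̂ : Ê → Bool
    F̂ ê = does (lifted? ê) ∨ (inner (φ (P ê)) ê ∧ Fv (φ (P ê)) ê)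
    restrict : ∀ e → F̂ (ψ e) ≡ F e
    restrict e = trans (cong₂ _∨_ lifted (cong (_∧ Fv (φ (P (ψ e))) (ψ e)) (inner-ψ (φ (P (ψ e))) e)))
                       (∨-identityʳ (F e))
      where
      lifted : does (lifted? (ψ e)) ≡ F e
      lifted = bool-ext (witness (lifted? (ψ e))) λ f → dec-true (lifted? (ψ e)) (e , refl , f)
        where
        witness : (d : Dec (∃ λ e' → ψ e' ≡ ψ e × F e' ≡ true)) → does d ≡ true → F e ≡ true
        witness (yes (e' , eq , f)) _ = subst (λ e → F e ≡ true) (ψ-inj e' e eq) f
    onTeeth : ∀ v → v ∈ B → ∀ ê → inner v ê ≡ true → F̂ ê ≡ Fv v ê
    onTeeth v v∈B ê i = subst (λ u → does (lifted? ê) ∨ (inner u ê ∧ Fv u ê) ≡ Fv v ê) (sym (proj₁ (inner-ends {v} {ê} i)))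
      (cong₂ _∨_ (dec-false (lifted? ê) unlifted) (cong (_∧ Fv v ê) i))
      where
      unlifted : ¬ (∃ λ e → ψ e ≡ ê × F e ≡ true)
      unlifted (e , eq , _) = true≢false (trans (sym i) (trans (cong (inner v) (sym eq)) (inner-ψ v e)))
    open Extension F F-min Fv (λ v v∈B → proj₂ (tooth v (v ∈? B)) v∈B) F̂ restrict onTeeth

  toothTarget : ∀ v x y → lookup ((Tt v Δ ⁅ r v ⁆) Δ ⁅ x ⁆) y ≡ T' v y xor single x y
  toothTarget v x y = trans (lookup-Δ (Tt v Δ ⁅ r v ⁆) ⁅ x ⁆ y)
    (cong₂ _xor_ (trans (lookup-Δ (Tt v) ⁅ r v ⁆ y) (cong (lookup (Tt v) y xor_) (lookup-⁅⁆ (r v) y))) (lookup-⁅⁆ x y))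

  fits⇒min : ∀ {v x} → v ∈ B → Contact v x → ∀ {J} → Fits v x J →
    MinJoinIn (fibre φ v) (lookup ((Tt v Δ ⁅ r v ⁆) Δ ⁅ x ⁆)) J
  fits⇒min {v} {x} v∈B x∈ (join , cnt) = JoinIn-target (λ y → sym (toothTarget v x y)) join , λ K joinK →
    subst (_≤ count K) (sym cnt) (Size.lower v v∈B (single x)
      (λ y h → subst (Contact v) (⌊⌋-sound h) x∈) K (JoinIn-target (toothTarget v x) joinK))

  -- The join of size n_v from `Size.attained` bounds a minimum join from above, and the tooth bound
  -- with the singleton `X` bounds it from below.
  min⇒fits : ∀ {v x} → v ∈ B → Contact v x → ∀ {J} →
    MinJoinIn (fibre φ v) (lookup ((Tt v Δ ⁅ r v ⁆) Δ ⁅ x ⁆)) J → Fits v x J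
  min⇒fits {v} {x} v∈B x∈ {J} (join , least) = join' , ℕₚ.≤-antisym
    (let K , joinK , cnt = Size.attained v v∈B x x∈ in
     ℕₚ.≤-trans (least K (JoinIn-target (λ y → sym (toothTarget v x y)) joinK)) (ℕₚ.≤-reflexive cnt))
    (Size.lower v v∈B (single x) (λ y h → subst (Contact v) (⌊⌋-sound h) x∈) J join')
    where
    join' = JoinIn-target (toothTarget v x) join

  -- Characterising the minimum joins of the synthesis.

  TeethMinimal : Subset (nE G) → (V → Subset (nE Ĝ)) → Set
  TeethMinimal F Fv = ∀ v → v ∈ B → ∀ e → e ∈ F → IsEnd G v e →
    ∀ x → x ∈ fibre φ v → IsEnd Ĝ x (ψ e) →
    IsMinJoinIn Ĝ (fibre φ v) ((Tt v Δ ⁅ r v ⁆) Δ ⁅ x ⁆) (Fv v)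

  Assembles : Subset (nE Ĝ) → Subset (nE G) → (V → Subset (nE Ĝ)) → Set
  Assembles F̂ F Fv = ∀ ê → (ê ∈ F̂) ⇔ ((∃ λ e → (e ∈ F) × (ψ e ≡ ê)) ⊎ (∃ λ v → (v ∈ B) × (ê ∈ Fv v)))

  assembled⇒min : ∀ F̂ F Fv → IsMinJoin G T F → TeethMinimal F Fv → Assembles F̂ F Fv → IsMinJoin Ĝ T̂ F̂
  assembled⇒min F̂ F Fv minF teeth asm = isMinJoinIn⇐
    (Extension.extension-min (lookup F) F-min (lookup ∘ Fv) fits (lookup F̂) restrict onTeeth)
    where
    F-min : MinJoin (lookup F)
    F-min = GL.isMinJoinIn⇒ minF
    fits : ∀ v v∈B → Fits v (Attachment.vertex (attachment (lookup F) F-min v v∈B)) (lookup (Fv v))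
    fits v v∈B = min⇒fits v∈B (contact v∈B (cross-ψ edge) vertex∈ isEndOf)
      (isMinJoinIn⇒ (teeth v v∈B edge (true⇒∈ edge∈) atTooth vertex (∈fibre vertex∈) isEndOf))
      where open Attachment (attachment (lookup F) F-min v v∈B)
    teeth-inner : ∀ v → v ∈ B → ∀ ê → ê ∈ Fv v → inner v ê ≡ true
    teeth-inner v v∈B ê h = inside⇒inner (proj₁ (proj₁ (fits v v∈B))) ê (∈⇒true h)
    restrict : ∀ e → lookup F̂ (ψ e) ≡ lookup F e
    restrict e = bool-ext (λ h → down (to (asm (ψ e)) (true⇒∈ h)))
                          (λ h → ∈⇒true (from (asm (ψ e)) (inj₁ (e , true⇒∈ h , refl))))
      where
      down : (∃ λ e' → (e' ∈ F) × (ψ e' ≡ ψ e)) ⊎ (∃ λ v → (v ∈ B) × (ψ e ∈ Fv v)) → lookup F e ≡ true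
      down (inj₁ (e' , e'∈ , eq)) = ∈⇒true (subst (_∈ F) (ψ-inj e' e eq) e'∈)
      down (inj₂ (v , v∈B , h))   = contradiction (trans (sym (teeth-inner v v∈B (ψ e) h)) (inner-ψ v e)) true≢false
    onTeeth : ∀ v → v ∈ B → ∀ ê → inner v ê ≡ true → lookup F̂ ê ≡ lookup (Fv v) ê
    onTeeth v v∈B ê i = bool-ext (λ h → down (to (asm ê) (true⇒∈ h)))
                                 (λ h → ∈⇒true (from (asm ê) (inj₂ (v , v∈B , true⇒∈ h))))
      where
      down : (∃ λ e → (e ∈ F) × (ψ e ≡ ê)) ⊎ (∃ λ v → (v ∈ B) × (ê ∈ Fv v)) → lookup (Fv v) ê ≡ true
      down (inj₁ (e , _ , refl))  = contradiction (trans (sym i) (inner-ψ v e)) true≢false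
      down (inj₂ (w , w∈B , h))   =
        ∈⇒true (subst (λ u → ê ∈ Fv u) (inner-unique i (teeth-inner w w∈B ê h)) h)

  min⇒assembled : ∀ F̂ → IsMinJoin Ĝ T̂ F̂ →
    Σ (Subset (nE G)) λ F → Σ (V → Subset (nE Ĝ)) λ Fv → IsMinJoin G T F × TeethMinimal F Fv × Assembles F̂ F Fv
  min⇒assembled F̂ minF̂ = tabulate F , (λ v → tabulate (Fv v)) ,
    GL.isMinJoinIn⇐ (GL.MinJoinIn-cong (sym ∘ lookup∘tabulate F) F-min) , teeth , assembles
    where
    J : Ê → Bool
    J = lookup F̂
    J-min : MinJoinIn ⊤ (lookup T̂) J
    J-min = isMinJoinIn⇒ minF̂
    J-join : Join^ J
    J-join = proj₁ J-min
    F : E → Bool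
    F = J ∘ ψ
    Fv : V → Ê → Bool
    Fv v = J ⊓ inner v
    -- A minimum join of `G`, extended to `Ĝ`, bounds the size of `F̂` from above. Against
    -- `count-lower` this leaves no slack, neither in the skeleton part nor in any tooth.
    F₁ : ∃ MinJoin
    F₁ = GL.leastJoin (contract-join J J-join)
    J₁ = extend (proj₁ F₁) (proj₂ F₁)
    J≤ : count J ≤ count (proj₁ F₁) + ∑.sum size
    J≤ = ℕₚ.≤-trans (proj₂ J-min (proj₁ J₁) (proj₁ (proj₁ (proj₂ J₁)))) (ℕₚ.≤-reflexive (proj₂ (proj₂ (proj₂ J₁))))
    F-min : MinJoin F
    F-min = contract-join J J-join , λ K joinK → ℕₚ.≤-trans
      (ℕₚ.+-cancelʳ-≤ (∑.sum size) (count F) (count (proj₁ F₁)) (ℕₚ.≤-trans (count-lower J J-join) J≤))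
      (proj₂ (proj₂ F₁) K joinK)
    teeth-tight : ∑.sum (λ v → count (Fv v)) ≤ ∑.sum size
    teeth-tight = ℕₚ.+-cancelˡ-≤ (count F) _ _ (begin
      count F + ∑.sum (λ v → count (Fv v))   ≡⟨ count-split J ⟨
      count J                                ≤⟨ J≤ ⟩
      count (proj₁ F₁) + ∑.sum size          ≤⟨ ℕₚ.+-monoˡ-≤ (∑.sum size) (proj₂ (proj₂ F₁) F (contract-join J J-join)) ⟩
      count F + ∑.sum size ∎)
      where open ℕₚ.≤-Reasoning
    teeth-size : ∀ v → size v ≡ count (Fv v)
    teeth-size = sum-tight size (λ v → count (Fv v)) (tooth-lower J J-join) teeth-tight
    teeth : TeethMinimal (tabulate F) (λ v → tabulate (Fv v))
    teeth v v∈B e e∈ atTooth x x∈ end = isMinJoinIn⇐ (MinJoinIn-cong (sym ∘ lookup∘tabulate (Fv v))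
      (fits⇒min v∈B (contact v∈B (cross-ψ e) (fibre∋ x∈) end)
        ((inside-inner J , λ y y∈ → trans (proj₂ (tooth-join J J-join v v∈B) y y∈)
            (cong (T' v y xor_) (trans (cong₂ _∧_ (⌊⌋-true (fibre∋ y∈)) (∂-cross J F (λ _ → refl) a y (fibre∋ y∈)))
                                       (cong (λ z → single z y) vertex≡x)))) ,
         sym (teeth-size v))))
      where
      a = attachment F F-min v v∈B
      open Attachment a hiding (atTooth)
      vertex≡x : vertex ≡ x
      vertex≡x = same-end (trans vertex∈ (sym (fibre∋ x∈))) isEndOf
        (subst (λ e → IsEnd Ĝ x (ψ e)) (unique e (trans (sym (lookup∘tabulate F e)) (∈⇒true e∈)) atTooth) end)
    assembles : Assembles F̂ (tabulate F) (λ v → tabulate (Fv v))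
    assembles ê = mk⇔ (λ h → up (∈⇒true h) (φ (P ê) ≟ φ (Q ê))) (true⇒∈ ∘ down)
      where
      up : J ê ≡ true → Dec (φ (P ê) ≡ φ (Q ê)) →
        (∃ λ e → (e ∈ tabulate F) × (ψ e ≡ ê)) ⊎ (∃ λ v → (v ∈ B) × (ê ∈ tabulate (Fv v)))
      up h (no ne) with e , refl ← from (ψ-image ê) ne = inj₁ (e , true⇒∈ (trans (lookup∘tabulate F e) h) , refl)
      up h (yes eq) = inj₂ (φ (P ê) , inner⇒B i , true⇒∈ (trans (lookup∘tabulate (Fv (φ (P ê))) ê) (∧-intro h i)))
        where
        i : inner (φ (P ê)) ê ≡ true
        i = ends⇒inner refl (sym eq)
      down : (∃ λ e → (e ∈ tabulate F) × (ψ e ≡ ê)) ⊎ (∃ λ v → (v ∈ B) × (ê ∈ tabulate (Fv v))) → J ê ≡ true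
      down (inj₁ (e , h , refl)) = trans (sym (lookup∘tabulate F e)) (∈⇒true h)
      down (inj₂ (v , _ , h))    = ∧-trueˡ {J ê} (trans (sym (lookup∘tabulate (Fv v) ê)) (∈⇒true h))

  containing : ∀ F → IsMinJoin G T F → ∃ λ F̂ → IsMinJoin Ĝ T̂ F̂ × (∀ e → e ∈ F → ψ e ∈ F̂)
  containing F minF =
    let F̂ , min , restrict , _ = extend (lookup F) (GL.isMinJoinIn⇒ minF) in
    tabulate F̂ , isMinJoinIn⇐ (MinJoinIn-cong (sym ∘ lookup∘tabulate F̂) min) ,
    λ e e∈ → true⇒∈ (trans (lookup∘tabulate F̂ (ψ e)) (trans (restrict e) (∈⇒true e∈)))

theorem7p10 : (G : Graph) (T A B : Subset (nV G))
    (Ĝ : Graph) (T̂ : Subset (nV Ĝ))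
    (φ : Fin (nV Ĝ) → Fin (nV G)) (ψ : Fin (nE G) → Fin (nE Ĝ))
    (Tt Av Bv : Fin (nV G) → Subset (nV Ĝ)) (r : Fin (nV G) → Fin (nV Ĝ)) →
    IsSynthesis G T A B Ĝ T̂ φ ψ Tt Av Bv r →
    (∀ (F̂ : Subset (nE Ĝ)) →
    IsMinJoin Ĝ T̂ F̂ ⇔
    (Σ (Subset (nE G)) λ F → Σ (Fin (nV G) → Subset (nE Ĝ)) λ Fv →
    IsMinJoin G T F
    × (∀ v → v ∈ B → ∀ e → e ∈ F → IsEnd G v e →
    ∀ x → x ∈ fibre φ v → IsEnd Ĝ x (ψ e) →
    IsMinJoinIn Ĝ (fibre φ v) ((Tt v Δ ⁅ r v ⁆) Δ ⁅ x ⁆) (Fv v))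
    × (∀ ê → (ê ∈ F̂) ⇔ ((∃ λ e → (e ∈ F) × (ψ e ≡ ê))
    ⊎ (∃ λ v → (v ∈ B) × (ê ∈ Fv v))))))
    × (∀ (F : Subset (nE G)) → IsMinJoin G T F →
    ∃ λ F̂ → IsMinJoin Ĝ T̂ F̂ × (∀ e → e ∈ F → ψ e ∈ F̂))
theorem7p10 G T A B Ĝ T̂ φ ψ Tt Av Bv r syn =
  (λ F̂ → mk⇔ (min⇒assembled F̂) λ (F , Fv , minF , teeth , asm) → assembled⇒min F̂ F Fv minF teeth asm) ,
  containing
  where open Synthesis G T A B Ĝ T̂ φ ψ Tt Av Bv r syn
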